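{- For every integer $n\ge 1$, the peak-nesting polynomial $\mathrm{Pnest}_n(t)=\sum_{\mathbf a\in\mathcal{DP}(n)}t^{\mathrm{pnest}(\mathbf a)}$ satisfies $$\mathrm{Pnest}_n(t)=\sum_{i=0}^{\lfloor\frac{n-1}{2}\rfloor}2^{n-1-2i}\sum_{\substack{M\in\mathcal{MP}(n)\\ \mathrm{u}(M)=i}}t^{\mathrm{height}(M)+1}=\sum_{i=0}^{\lfloor\frac{n-1}{2}\rfloor}2^{n-1-2i}\binom{n-1}{2i}\sum_{D\in\mathrm{Dyck}(i)}t^{\mathrm{height}(D)+1},$$ where $\mathcal{MP}(n)$ is the set of Motzkin paths of length $n-1$ and $\mathrm{Dyck}(i)$ is the set of Dyck paths of semilength $i$.
   Context: Write $[n]=\{1,\dots,n\}$. An area sequence of size $n$ is a sequence $\mathbf a=(a_1,\dots,a_n)$ of nonnegative integers with $a_i<i$ for all $i$ and $a_i\le a_{i-1}+1$ for all $i\ge 2$; $\mathcal{DP}(n)$ is the set of all of them. Each $\mathbf a\in\mathcal{DP}(n)$ defines a graph $\Gamma_{\mathbf a}$ (a unit interval graph) on $[n]$ with edges $\{j,i\}$ for $1\le j<i\le n$ with $i-a_i\le j$. If $\{i,j\}$ with $i<j$ is an edge then $\{i,i+1,\dots,j\}$ is a clique. A peak-edge of $\Gamma_{\mathbf a}$ is either an isolated vertex $i$ (put $j=i$) or an edge $\{i,j\}$, $i<j$, such that neither $\{i,j+1\}$ nor $\{i-1,j\}$ is an edge (pairs not contained in $[n]$ are not edges). The corresponding peak-clique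 is $\{i,i+1,\dots,j\}$. The peak-nesting of a vertex is the number of peak-cliques containing it, and $\mathrm{pnest}(\mathbf a)$ is the maximum of these numbers over all vertices. A Motzkin path of length $m\ge0$ is a lattice path from $(0,0)$ to $(m,0)$ with steps $U=(1,1)$, $D=(1,-1)$, $H=(1,0)$ that never goes below the $x$-axis; $\mathrm{u}(M)$ is its number of $U$ steps and $\mathrm{height}(M)$ is the largest $y$-coordinate it attains (0 for the empty path). A Dyck path of semilength $i$ is a Motzkin path of length $2i$ with no $H$ steps, and its height is defined in the same way. -}

module Defs where

open import Data.Fin as Fin using (Fin; toℕ; fromℕ)
import Data.Fin.Properties as Fin
open import Data.Integer as ℤ using (ℤ; 0ℤ; 1ℤ; -1ℤ; ∣_∣)
import Data.Integer.Properties as ℤ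
open import Data.List as List
  using (List; []; _∷_; [_]; allFin; upTo; cartesianProduct; cartesianProductWith; filter)
open import Data.List.Extrema.Nat using (max)
open import Data.List.Membership.Propositional using (_∈_)
open import Data.List.Membership.Propositional.Properties
  using (∈-cartesianProductWith⁺; ∈-filter⁺; ∈-filter⁻; ∈-upTo⁺)
open import Data.List.Relation.Unary.All as ListAll using ()
open import Data.List.Relation.Unary.Any using (here; there)
open import Data.List.Relation.Unary.AllPairs as AllPairs using ()
open import Data.List.Relation.Unary.Unique.Propositional using (Unique)
open import Data.List.Relation.Unary.Unique.Propositional.Properties as Unique using ()
open import Data.Nat
open import Data.Nat.Properties
open import Data.Product using (_×_; _,_; proj₁; proj₂)
open import Data.Sum using (_⊎_)
open import Data.Vec as Vec using (Vec; []; _∷_; lookup)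
open import Data.Vec.Properties using (∷-injective)
open import Data.Vec.Relation.Unary.All as All using (All)
open import Function using (_⇔_; mk⇔)
open import Relation.Binary.PropositionalEquality using (_≡_; refl)
open import Relation.Nullary using (Dec; yes; no; ¬_; ¬?; _×-dec_; _⊎-dec_; _→-dec_)

------------------------------------------------------------------------
-- Polynomials in one variable t over ℕ

-- The coefficient of t ^ k is the k-th entry (0 past the end). Distinct lists
-- may denote the same polynomial, so polynomials are compared with _≈ᵖ_.
Poly : Set
Poly = List ℕ

coeff : Poly → ℕ → ℕ
coeff []      _       = 0
coeff (c ∷ _) zero    = c
coeff (_ ∷ p) (suc k) = coeff p k

infix 4 _≈ᵖ_
_≈ᵖ_ : Poly → Poly → Set
p ≈ᵖ q = ∀ k → coeff p k ≡ coeff q k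

infixl 6 _+ᵖ_
_+ᵖ_ : Poly → Poly → Poly
[]      +ᵖ q       = q
(c ∷ p) +ᵖ []      = c ∷ p
(c ∷ p) +ᵖ (d ∷ q) = c + d ∷ p +ᵖ q

infixr 7 _·ᵖ_
_·ᵖ_ : ℕ → Poly → Poly
c ·ᵖ p = List.map (c *_) p

infix 8 t^_
t^_ : ℕ → Poly
t^ zero  = [ 1 ]
t^ suc k = 0 ∷ t^ k

Σᵖ : {A : Set} → List A → (A → Poly) → Poly
Σᵖ xs f = List.foldr (λ x p → f x +ᵖ p) [] xs

infix 5 Σᵖ
syntax Σᵖ xs (λ x → p) = Σᵖ[ x ∈ xs ] p

------------------------------------------------------------------------
-- Enumeration of the vectors with entries in a list

vectors : {A : Set} → List A → (n : ℕ) → List (Vec A n)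
vectors xs zero    = [ [] ]
vectors xs (suc n) = cartesianProductWith _∷_ xs (vectors xs n)

∈-vectors : ∀ {A : Set} {xs : List A} {n} (v : Vec A n) →
            (∀ i → lookup v i ∈ xs) → v ∈ vectors xs n
∈-vectors []      _ = here refl
∈-vectors (x ∷ v) h =
  ∈-cartesianProductWith⁺ _∷_ (h Fin.zero) (∈-vectors v (λ i → h (Fin.suc i)))

vectors-unique : ∀ {A : Set} {xs : List A} → Unique xs → ∀ n → Unique (vectors xs n)
vectors-unique xs! zero    = ListAll.[] AllPairs.∷ AllPairs.[]
vectors-unique xs! (suc n) =
  Unique.cartesianProductWith⁺ _∷_ ∷-injective xs! (vectors-unique xs! n)

------------------------------------------------------------------------
-- Area sequences

-- The element of [n] = {1,…,n} represented by an element of Fin n.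
label : ∀ {n} → Fin n → ℕ
label i = suc (toℕ i)

IsAreaSequence : ∀ {n} → Vec ℕ n → Set
IsAreaSequence {n} a =
    (∀ (i : Fin n) → lookup a i < label i)
  × (∀ (i j : Fin n) → label i ≡ suc (label j) → lookup a i ≤ lookup a j + 1)

isAreaSequence? : ∀ {n} (a : Vec ℕ n) → Dec (IsAreaSequence a)
isAreaSequence? a =
  Fin.all? (λ i → lookup a i <? label i)
  ×-dec
  Fin.all? (λ i → Fin.all? λ j →
    (label i ≟ suc (label j)) →-dec (lookup a i ≤? lookup a j + 1))

-- Entries of an area sequence of size n are less than n, so none is missed.
DP : (n : ℕ) → List (Vec ℕ n)
DP n = filter isAreaSequence? (vectors (upTo n) n)

∈-DP : ∀ {n} (a : Vec ℕ n) → a ∈ DP n ⇔ IsAreaSequence a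
∈-DP {n} a = mk⇔
  (λ a∈ → proj₂ (∈-filter⁻ isAreaSequence? {xs = vectors (upTo n) n} a∈))
  (λ h → ∈-filter⁺ isAreaSequence?
    (∈-vectors a (λ i → ∈-upTo⁺ (<-≤-trans (proj₁ h i) (Fin.toℕ<n i)))) h)

DP-unique : ∀ n → Unique (DP n)
DP-unique n = Unique.filter⁺ isAreaSequence? (vectors-unique (Unique.upTo⁺ n) n)

------------------------------------------------------------------------
-- The unit interval graph of an area sequence and its peak-nesting

-- {j , i} is an edge with j < i
OrderedEdge : ∀ {n} → Vec ℕ n → Fin n → Fin n → Set
OrderedEdge a j i = label j < label i × label i ∸ lookup a i ≤ label j

Edge : ∀ {n} → Vec ℕ n → Fin n → Fin n → Set
Edge a i j = OrderedEdge a i j ⊎ OrderedEdge a j i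

edge? : ∀ {n} (a : Vec ℕ n) (i j : Fin n) → Dec (Edge a i j)
edge? a i j = ordered? i j ⊎-dec ordered? j i
  where
  ordered? : ∀ j i → Dec (OrderedEdge a j i)
  ordered? j i = (label j <? label i) ×-dec (label i ∸ lookup a i ≤? label j)

Isolated : ∀ {n} → Vec ℕ n → Fin n → Set
Isolated {n} a i = ∀ (j : Fin n) → ¬ Edge a i j

-- The neighbours j + 1 and i - 1 are quantified over, so that a pair leaving
-- [n] is not an edge.
PeakEdge : ∀ {n} → Vec ℕ n → Fin n → Fin n → Set
PeakEdge {n} a i j =
    (i ≡ j × Isolated a i)
  ⊎ ( label i < label j
    × Edge a i j
    × (∀ (k : Fin n) → label k ≡ suc (label j) → ¬ Edge a i k)
    × (∀ (k : Fin n) → suc (label k) ≡ label i → ¬ Edge a k j))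

peakEdge? : ∀ {n} (a : Vec ℕ n) (i j : Fin n) → Dec (PeakEdge a i j)
peakEdge? a i j =
  ((i Fin.≟ j) ×-dec Fin.all? (λ k → ¬? (edge? a i k)))
  ⊎-dec
  ((label i <? label j)
   ×-dec edge? a i j
   ×-dec Fin.all? (λ k → (label k ≟ suc (label j)) →-dec ¬? (edge? a i k))
   ×-dec Fin.all? (λ k → (suc (label k) ≟ label i) →-dec ¬? (edge? a k j)))

-- A peak-clique {i,…,j} is given by its pair of end points (i , j).
peakCliques : ∀ {n} → Vec ℕ n → List (Fin n × Fin n)
peakCliques {n} a =
  filter (λ (i , j) → peakEdge? a i j) (cartesianProduct (allFin n) (allFin n))

peakNesting : ∀ {n} → Vec ℕ n → Fin n → ℕ
peakNesting a v =
  List.length (filter (λ (i , j) → (label i ≤? label v) ×-dec (label v ≤? label j))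
                      (peakCliques a))

pnest : ∀ {n} → Vec ℕ n → ℕ
pnest {n} a = max 0 (List.map (peakNesting a) (allFin n))

Pnest : ℕ → Poly
Pnest n = Σᵖ[ a ∈ DP n ] t^ pnest a

------------------------------------------------------------------------
-- Motzkin and Dyck paths

data Step : Set where
  U D H : Step

_≟ˢ_ : (s s′ : Step) → Dec (s ≡ s′)
U ≟ˢ U = yes refl
U ≟ˢ D = no λ ()
U ≟ˢ H = no λ ()
D ≟ˢ U = no λ ()
D ≟ˢ D = yes refl
D ≟ˢ H = no λ ()
H ≟ˢ U = no λ ()
H ≟ˢ D = no λ ()
H ≟ˢ H = yes refl

rise : Step → ℤ
rise U = 1ℤ
rise D = -1ℤ
rise H = 0ℤ

-- The x-th entry is the y-coordinate at abscissa x of the path from (0 , y).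
ordinates : ∀ {m} → ℤ → Vec Step m → Vec ℤ (suc m)
ordinates y []      = y ∷ []
ordinates y (s ∷ p) = y ∷ ordinates (y ℤ.+ rise s) p

IsMotzkin : ∀ {m} → Vec Step m → Set
IsMotzkin {m} p =
    lookup (ordinates 0ℤ p) (fromℕ m) ≡ 0ℤ
  × All (0ℤ ℤ.≤_) (ordinates 0ℤ p)

isMotzkin? : ∀ {m} (p : Vec Step m) → Dec (IsMotzkin p)
isMotzkin? {m} p =
  (lookup (ordinates 0ℤ p) (fromℕ m) ℤ.≟ 0ℤ)
  ×-dec All.all? (0ℤ ℤ.≤?_) (ordinates 0ℤ p)

u : ∀ {m} → Vec Step m → ℕ
u p = Vec.count (U ≟ˢ_) p

-- Every path attains y-coordinate 0 at its start, so 0 is a harmless seed for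
-- the maximum, which is nonnegative.
height : ∀ {m} → Vec Step m → ℕ
height p = ∣ Vec.foldr′ ℤ._⊔_ 0ℤ (ordinates 0ℤ p) ∣

steps : List Step
steps = U ∷ D ∷ H ∷ []

motzkinPaths : (m : ℕ) → List (Vec Step m)
motzkinPaths m = filter isMotzkin? (vectors steps m)

∈-motzkinPaths : ∀ {m} (p : Vec Step m) → p ∈ motzkinPaths m ⇔ IsMotzkin p
∈-motzkinPaths {m} p = mk⇔
  (λ p∈ → proj₂ (∈-filter⁻ isMotzkin? {xs = vectors steps m} p∈))
  (λ h → ∈-filter⁺ isMotzkin? (∈-vectors p (λ i → ∈-steps (lookup p i))) h)
  where
  ∈-steps : ∀ s → s ∈ steps
  ∈-steps U = here refl
  ∈-steps D = there (here refl)
  ∈-steps H = there (there (here refl))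

motzkinPaths-unique : ∀ m → Unique (motzkinPaths m)
motzkinPaths-unique m = Unique.filter⁺ isMotzkin? (vectors-unique steps! m)
  where
  steps! : Unique steps
  steps! = ((λ ()) ListAll.∷ (λ ()) ListAll.∷ ListAll.[])
           AllPairs.∷ ((λ ()) ListAll.∷ ListAll.[])
           AllPairs.∷ ListAll.[] AllPairs.∷ AllPairs.[]

MP : (n : ℕ) → List (Vec Step (n ∸ 1))
MP n = motzkinPaths (n ∸ 1)

Dyck : (i : ℕ) → List (Vec Step (2 * i))
Dyck i = filter (λ p → All.all? (λ s → ¬? (s ≟ˢ H)) p) (motzkinPaths (2 * i))

{-# OPTIONS --safe #-}
module Submission where

-- Put bⱼ = j − aⱼ. The peak-cliques are the intervals {bⱼ,…,j} with j last or
-- bⱼ < bⱼ₊₁, so they are determined by the sets of their left and right ends.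
-- Reading off, for v = 1,…,n−1, whether v is a right end and whether v + 1 is a
-- left end gives a path: U if only the latter holds, D if only the former does,
-- and an H step of one of two colours otherwise. Its height after v − 1 steps is
-- one less than the peak-nesting of v, and every bicoloured Motzkin path of
-- length n − 1 arises exactly once. Forgetting the H steps, whose positions are
-- free, yields the Dyck path formula.
--
-- When the entries of 𝐚 are read from left to right, the left ends among
-- bⱼ+1,…,j depend on later entries. The bijection is therefore proved by
-- induction on the remaining length, jointly over the aⱼ undecided vertices.

open import Defs
open import Algebra.Properties.CommutativeSemigroup using (interchange)
open import Data.Bool using (Bool; true; false; if_then_else_)
open import Data.Empty using (⊥)
open import Data.Fin as Fin using (Fin; toℕ; fromℕ; fromℕ<; inject₁)
import Data.Fin.Properties as Fin
open import Data.Integer as ℤ using (ℤ; 0ℤ)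
open import Data.List
  using (List; []; _∷_; _++_; map; length; replicate; take; filter; upTo; allFin; tabulate;
         cartesianProductWith; cartesianProduct)
open import Data.List.Extrema.Nat using (max)
open import Data.List.Properties
  using (map-++; map-∘; map-cong; map-tabulate; upTo-∷ʳ; take-take; ++-identityʳ)
open import Data.Nat
  using (ℕ; zero; suc; pred; _+_; _*_; _∸_; _^_; _⊔_; _≤_; _<_; _≟_; _≤?_; ⌊_/2⌋; z≤n; s≤s; s≤s⁻¹)
open import Data.Nat.Combinatorics
  using (_C_; nCk≡nC[n∸k]; nCn≡1; k>n⇒nCk≡0; nCk+nC[k+1]≡[n+1]C[k+1])
open import Data.Nat.ListAction using (sum)
open import Data.Nat.ListAction.Properties using (sum-++)
open import Data.Nat.Properties
open import Data.Product using (_×_; _,_; map₂)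
open import Data.Sum using (inj₁; inj₂; swap)
open import Data.Unit using (⊤; tt)
open import Data.Vec as Vec using (Vec; []; _∷_; lookup)
open import Data.Vec.Relation.Unary.All as All using (All; []; _∷_)
open import Function using (_∘_; id; mk⇔)
open import Relation.Binary.PropositionalEquality
open import Relation.Nullary
  using (Dec; yes; no; does; ¬_; ¬?; contradiction; _×-dec_; _→-dec_)
open import Relation.Nullary.Decidable using (does-⇔; dec-true; dec-false)
open import Relation.Unary using (Pred; Decidable)

open ≡-Reasoning

private
  variable
    A B P Q : Set

-- Finite sums

∑ : List A → (A → ℕ) → ℕ
∑ xs f = sum (map f xs)

∑-cong : (xs : List A) {f g : A → ℕ} → (∀ x → f x ≡ g x) → ∑ xs f ≡ ∑ xs g
∑-cong xs f≗g = cong sum (map-cong f≗g xs)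

∑-zero : (xs : List A) → ∑ xs (λ _ → 0) ≡ 0
∑-zero []       = refl
∑-zero (_ ∷ xs) = ∑-zero xs

∑-++ : ∀ xs ys (f : A → ℕ) → ∑ (xs ++ ys) f ≡ ∑ xs f + ∑ ys f
∑-++ xs ys f = trans (cong sum (map-++ f xs ys)) (sum-++ (map f xs) (map f ys))

∑-map : ∀ xs (g : A → B) (f : B → ℕ) → ∑ (map g xs) f ≡ ∑ xs (f ∘ g)
∑-map xs g f = cong sum (sym (map-∘ xs))

∑-+ : (xs : List A) (f g : A → ℕ) → ∑ xs (λ x → f x + g x) ≡ ∑ xs f + ∑ xs g
∑-+ []       f g = refl
∑-+ (x ∷ xs) f g = trans
  (cong (λ z → f x + g x + z) (∑-+ xs f g))
  (interchange +-commutativeSemigroup (f x) (g x) (∑ xs f) (∑ xs g))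

∑-*ˡ : ∀ c (xs : List A) (f : A → ℕ) → ∑ xs (λ x → c * f x) ≡ c * ∑ xs f
∑-*ˡ c []       f = sym (*-zeroʳ c)
∑-*ˡ c (x ∷ xs) f = trans (cong (λ z → c * f x + z) (∑-*ˡ c xs f)) (sym (*-distribˡ-+ c (f x) (∑ xs f)))

∑-swap : ∀ (xs : List A) (ys : List B) (f : A → B → ℕ) →
         ∑ xs (λ x → ∑ ys (f x)) ≡ ∑ ys (λ y → ∑ xs (λ x → f x y))
∑-swap []       ys f = sym (∑-zero ys)
∑-swap (x ∷ xs) ys f = trans (cong (λ z → ∑ ys (f x) + z) (∑-swap xs ys f)) (sym (∑-+ ys (f x) _))

∑-cartesianProductWith : ∀ {C : Set} (_∙_ : A → B → C) xs ys (f : C → ℕ) →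
  ∑ (cartesianProductWith _∙_ xs ys) f ≡ ∑ xs (λ x → ∑ ys (λ y → f (x ∙ y)))
∑-cartesianProductWith _∙_ []       ys f = refl
∑-cartesianProductWith _∙_ (x ∷ xs) ys f =
  trans (∑-++ (map (x ∙_) ys) _ f)
        (cong₂ _+_ (∑-map ys (x ∙_) f) (∑-cartesianProductWith _∙_ xs ys f))

∑-allFin : ∀ n (f : Fin (suc n) → ℕ) → ∑ (allFin (suc n)) f ≡ f Fin.zero + ∑ (allFin n) (f ∘ Fin.suc)
∑-allFin n f = cong (λ l → f Fin.zero + sum l) (trans (map-tabulate Fin.suc f) (sym (map-tabulate id (f ∘ Fin.suc))))

length-∑ : (xs : List A) → length xs ≡ ∑ xs (λ _ → 1)
length-∑ []       = refl
length-∑ (_ ∷ xs) = cong suc (length-∑ xs)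

-- Indicator factor of a summand. It depends on the decision only through `does`, so equivalent
-- conditions can be exchanged inside a sum.
when : Dec P → ℕ → ℕ
when p x = if does p then x else 0

when-⇔ : (P → Q) → (Q → P) → (p : Dec P) (q : Dec Q) → ∀ x → when p x ≡ when q x
when-⇔ f g p q x = cong (if_then x else 0) (does-⇔ (mk⇔ f g) p q)

when-cong : (p : Dec P) → ∀ {x y} → (P → x ≡ y) → when p x ≡ when p y
when-cong (yes p) h = h p
when-cong (no  _) h = refl

when-yes : (p : Dec P) → P → ∀ x → when p x ≡ x
when-yes p h x = cong (if_then x else 0) (dec-true p h)

when-no : (p : Dec P) → ¬ P → ∀ x → when p x ≡ 0
when-no p h x = cong (if_then x else 0) (dec-false p h)

when-0 : (p : Dec P) → when p 0 ≡ 0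
when-0 (yes _) = refl
when-0 (no  _) = refl

when-× : (p : Dec P) (q : Dec Q) → ∀ x → when (p ×-dec q) x ≡ when p (when q x)
when-× (yes _) q x = refl
when-× (no  _) q x = refl

when-* : ∀ c (p : Dec P) x → c * when p x ≡ when p (c * x)
when-* c (yes _) x = refl
when-* c (no  _) x = *-zeroʳ c

∑-when : (xs : List A) (p : Dec P) (f : A → ℕ) → ∑ xs (λ x → when p (f x)) ≡ when p (∑ xs f)
∑-when xs (yes _) f = refl
∑-when xs (no  _) f = ∑-zero xs

∑-filter : {P : Pred A _} (P? : Decidable P) → ∀ xs (f : A → ℕ) →
           ∑ (filter P? xs) f ≡ ∑ xs (λ x → when (P? x) (f x))
∑-filter P? []       f = refl
∑-filter P? (x ∷ xs) f with does (P? x)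
... | true  = cong (f x +_) (∑-filter P? xs f)
... | false = ∑-filter P? xs f

-- The top index is summed first, so that the entry x = a + 1 in `∑chains` splits off by
-- computation.
Σ< : ℕ → (ℕ → ℕ) → ℕ
Σ< zero    f = 0
Σ< (suc n) f = f n + Σ< n f

Σ<-cong : ∀ n {f g : ℕ → ℕ} → (∀ x → x < n → f x ≡ g x) → Σ< n f ≡ Σ< n g
Σ<-cong zero    h = refl
Σ<-cong (suc n) h = cong₂ _+_ (h n ≤-refl) (Σ<-cong n λ x x<n → h x (m<n⇒m<1+n x<n))

Σ<-zero : ∀ n → Σ< n (λ _ → 0) ≡ 0
Σ<-zero zero    = refl
Σ<-zero (suc n) = Σ<-zero n

∑-upTo : ∀ n (f : ℕ → ℕ) → ∑ (upTo n) f ≡ Σ< n f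
∑-upTo zero    f = refl
∑-upTo (suc n) f = begin
  ∑ (upTo (suc n)) f         ≡⟨ cong (λ l → ∑ l f) (upTo-∷ʳ n) ⟨
  ∑ (upTo n ++ n ∷ []) f     ≡⟨ ∑-++ (upTo n) (n ∷ []) f ⟩
  ∑ (upTo n) f + (f n + 0)   ≡⟨ cong₂ _+_ (∑-upTo n f) (+-identityʳ (f n)) ⟩
  Σ< n f + f n               ≡⟨ +-comm (Σ< n f) (f n) ⟩
  f n + Σ< n f               ∎

Σ<-indicator : ∀ n {j} (f : ℕ → ℕ) → j < n → Σ< n (λ i → when (j ≟ i) (f i)) ≡ f j
Σ<-indicator (suc n) {j} f j<1+n with m≤n⇒m<n∨m≡n (s≤s⁻¹ j<1+n)
... | inj₁ j<n = cong₂ _+_ (when-no (j ≟ n) (<⇒≢ j<n) (f n)) (Σ<-indicator n f j<n)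
... | inj₂ refl = begin
  when (n ≟ n) (f n) + Σ< n (λ i → when (n ≟ i) (f i))
    ≡⟨ cong₂ _+_ (when-yes (n ≟ n) refl (f n))
         (trans (Σ<-cong n λ i i<n → when-no (n ≟ i) (<⇒≢ i<n ∘ sym) (f i)) (Σ<-zero n)) ⟩
  f n + 0 ≡⟨ +-identityʳ (f n) ⟩
  f n     ∎

Σ<-bounded : ∀ n {m} (f : ℕ → ℕ) → m ≤ n → Σ< n (λ i → when (suc i ≤? m) (f i)) ≡ Σ< m f
Σ<-bounded zero    f z≤n = refl
Σ<-bounded (suc n) {m} f m≤1+n with m≤n⇒m<n∨m≡n m≤1+n
... | inj₁ m<1+n = cong₂ _+_ (when-no (suc n ≤? m) (<⇒≱ m<1+n) (f n)) (Σ<-bounded n f (s≤s⁻¹ m<1+n))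
... | inj₂ refl  = Σ<-cong (suc n) λ i i<m → when-yes (suc i ≤? suc n) i<m (f i)

∑-label : ∀ n {b} y → b < n → ∑ (allFin n) (λ i → when (label i ≟ suc b) y) ≡ y
∑-label (suc n) {zero} y _ = begin
  ∑ (allFin (suc n)) (λ i → when (label i ≟ 1) y)
    ≡⟨ ∑-allFin n _ ⟩
  y + ∑ (allFin n) (λ i → when (suc (label i) ≟ 1) y)
    ≡⟨ cong (y +_) (trans (∑-cong (allFin n) λ i → when-no (suc (label i) ≟ 1) (λ ()) y) (∑-zero (allFin n))) ⟩
  y + 0 ≡⟨ +-identityʳ y ⟩
  y ∎
∑-label (suc n) {suc b} y (s≤s b<n) = begin
  ∑ (allFin (suc n)) (λ i → when (label i ≟ suc (suc b)) y)
    ≡⟨ ∑-allFin n (λ i → when (label i ≟ suc (suc b)) y) ⟩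
  ∑ (allFin n) (λ i → when (suc (label i) ≟ suc (suc b)) y)
    ≡⟨ ∑-cong (allFin n) (λ i → when-⇔ suc-injective (cong suc) (suc (label i) ≟ suc (suc b)) (label i ≟ suc b) y) ⟩
  ∑ (allFin n) (λ i → when (label i ≟ suc b) y)
    ≡⟨ ∑-label n y b<n ⟩
  y ∎

-- Coefficients of sums and multiples of polynomials

coeff-+ᵖ : ∀ p q k → coeff (p +ᵖ q) k ≡ coeff p k + coeff q k
coeff-+ᵖ []      q       k       = refl
coeff-+ᵖ (c ∷ p) []      k       = sym (+-identityʳ _)
coeff-+ᵖ (c ∷ p) (d ∷ q) zero    = refl
coeff-+ᵖ (c ∷ p) (d ∷ q) (suc k) = coeff-+ᵖ p q k

coeff-·ᵖ : ∀ c p k → coeff (c ·ᵖ p) k ≡ c * coeff p k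
coeff-·ᵖ c []      k       = sym (*-zeroʳ c)
coeff-·ᵖ c (d ∷ p) zero    = refl
coeff-·ᵖ c (d ∷ p) (suc k) = coeff-·ᵖ c p k

coeff-Σᵖ : ∀ (xs : List A) f k → coeff (Σᵖ xs f) k ≡ ∑ xs (λ x → coeff (f x) k)
coeff-Σᵖ []       f k = refl
coeff-Σᵖ (x ∷ xs) f k = trans (coeff-+ᵖ (f x) (Σᵖ xs f) k) (cong (λ z → coeff (f x) k + z) (coeff-Σᵖ xs f k))

-- Flag lists and chains

trues : List Bool → ℕ
trues []          = 0
trues (true  ∷ q) = suc (trues q)
trues (false ∷ q) = trues q

∑flags : ℕ → (List Bool → ℕ) → ℕ
∑flags zero    f = f []
∑flags (suc n) f = ∑flags n (f ∘ (true ∷_)) + ∑flags n (f ∘ (false ∷_))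

∑flags-cong : ∀ n {f g : List Bool → ℕ} → (∀ q → f q ≡ g q) → ∑flags n f ≡ ∑flags n g
∑flags-cong zero    h = h []
∑flags-cong (suc n) h = cong₂ _+_ (∑flags-cong n (h ∘ (true ∷_))) (∑flags-cong n (h ∘ (false ∷_)))

-- The last flag is dropped by `take n` and enters through `trues` alone. `∑flags` branches on the
-- first flag instead, so the induction absorbs leading flags into `f`.
∑flags-snoc : ∀ n (f : List Bool → ℕ → ℕ) →
  ∑flags (suc n) (λ q → f (take n q) (trues q)) ≡ ∑flags n (λ q → f q (suc (trues q)) + f q (trues q))
∑flags-snoc zero    f = refl
∑flags-snoc (suc n) f = cong₂ _+_ (∑flags-snoc n (λ q t → f (true ∷ q) (suc t)))
                                  (∑flags-snoc n (λ q t → f (false ∷ q) t))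

trues-falses : ∀ n q → trues (replicate n false ++ q) ≡ trues q
trues-falses zero    q = refl
trues-falses (suc n) q = trues-falses n q

trues-take-falses : ∀ t n → trues (take t (replicate n false)) ≡ 0
trues-take-falses zero    n       = refl
trues-take-falses (suc t) zero    = refl
trues-take-falses (suc t) (suc n) = trues-take-falses t n

-- The flag lists of length n with a true flag, sorted by the length x of what
-- follows the first one.
∑flags-firstTrue : ∀ n (f : List Bool → ℕ) →
  Σ< n (λ x → ∑flags x (λ q → f (replicate (n ∸ suc x) false ++ true ∷ q))) + f (replicate n false)
    ≡ ∑flags n f
∑flags-firstTrue zero    f = refl
∑flags-firstTrue (suc n) f = begin
  (∑flags n (λ q → f (replicate (n ∸ n) false ++ true ∷ q))
    + Σ< n (λ x → ∑flags x (λ q → f (replicate (n ∸ x) false ++ true ∷ q))))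
    + f (false ∷ replicate n false)
    ≡⟨ +-assoc (∑flags n _) _ _ ⟩
  ∑flags n (λ q → f (replicate (n ∸ n) false ++ true ∷ q))
    + (Σ< n (λ x → ∑flags x (λ q → f (replicate (n ∸ x) false ++ true ∷ q)))
       + f (false ∷ replicate n false))
    ≡⟨ cong₂ _+_
         (∑flags-cong n λ q → cong (λ e → f (replicate e false ++ true ∷ q)) (n∸n≡0 n))
         (cong (_+ f (false ∷ replicate n false)) (Σ<-cong n λ x x<n → ∑flags-cong x λ q →
            cong (λ e → f (replicate e false ++ true ∷ q)) (∸-suc x<n))) ⟩
  ∑flags n (λ q → f (true ∷ q))
    + (Σ< n (λ x → ∑flags x (λ q → f (false ∷ replicate (n ∸ suc x) false ++ true ∷ q)))
       + f (false ∷ replicate n false))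
    ≡⟨ cong (∑flags n (f ∘ (true ∷_)) +_) (∑flags-firstTrue n (f ∘ (false ∷_))) ⟩
  ∑flags n (f ∘ (true ∷_)) + ∑flags n (f ∘ (false ∷_)) ∎
  where
  ∸-suc : ∀ {x n} → x < n → n ∸ x ≡ suc (n ∸ suc x)
  ∸-suc {x} {suc n} (s≤s x≤n) = +-∸-assoc 1 x≤n

extend : ℕ → ℕ → List Bool → List Bool
extend a x q = if does (x ≤? a) then replicate (a ∸ x) false ++ true ∷ q else q

-- If a is the j-th entry of an area sequence and c are the entries after it, the
-- list tells which of the vertices j−a+1,…,j are left ends of peak-cliques. When
-- x ≤ a is the next entry, the first of them that is one is j+1−x; vertex j+1
-- itself is cut off by take.
flags : ∀ {m} → ℕ → Vec ℕ m → List Bool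
flags a []      = replicate a false
flags a (x ∷ c) = take a (extend a x (flags x c))

maxTrues : ∀ {m} → ℕ → Vec ℕ m → ℕ
maxTrues a []      = 0
maxTrues a (x ∷ c) = trues (flags a (x ∷ c)) ⊔ maxTrues x c

-- The bound `suc (suc a)` encodes the step condition x ≤ a + 1 on the entry after a.
∑chains : ℕ → ∀ m → (Vec ℕ m → ℕ) → ℕ
∑chains a zero    f = f []
∑chains a (suc m) f = Σ< (suc (suc a)) (λ x → ∑chains x m (λ c → f (x ∷ c)))

-- The contribution of a down step, with default 0 at height 0, where there is none.
atPred : (ℕ → ℕ) → ℕ → ℕ
atPred f zero    = 0
atPred f (suc h) = f h

-- Sum of `f` at the maximal height, over the bicoloured Motzkin paths of length m from height h to
-- 0. The first bracket holds the first steps at which no clique ends (U and one colour of H), the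
-- second those at which one does (the other colour and D).
∑bicoloured : ℕ → ℕ → (ℕ → ℕ) → ℕ
∑bicoloured zero    zero    f = f 0
∑bicoloured zero    (suc h) f = 0
∑bicoloured (suc m) h       f =
  (∑bicoloured m (suc h) (f ∘ (h ⊔_)) + ∑bicoloured m h (f ∘ (h ⊔_)))
  + (∑bicoloured m h (f ∘ (h ⊔_)) + atPred (λ g → ∑bicoloured m g (f ∘ (h ⊔_))) h)

∑flags-+ : ∀ n (f g : List Bool → ℕ) → ∑flags n (λ q → f q + g q) ≡ ∑flags n f + ∑flags n g
∑flags-+ zero    f g = refl
∑flags-+ (suc n) f g = trans
  (cong₂ _+_ (∑flags-+ n (f ∘ (true ∷_)) (g ∘ (true ∷_))) (∑flags-+ n (f ∘ (false ∷_)) (g ∘ (false ∷_))))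
  (interchange +-commutativeSemigroup (∑flags n (f ∘ (true ∷_))) _ _ _)

-- Only the all-false list extends to an end at height 0.
∑flags-falses : ∀ n (f : List Bool → ℕ → ℕ) →
  ∑flags n (λ q → ∑bicoloured 0 (trues q) (f q)) ≡ f (replicate n false) 0
∑flags-falses zero    f = refl
∑flags-falses (suc n) f = cong₂ _+_ (∑flags-0 n) (∑flags-falses n (f ∘ (false ∷_)))
  where
  ∑flags-0 : ∀ n → ∑flags n (λ _ → 0) ≡ 0
  ∑flags-0 zero    = refl
  ∑flags-0 (suc n) = cong₂ _+_ (∑flags-0 n) (∑flags-0 n)

extend-> : ∀ a q → extend a (suc a) q ≡ q
extend-> a q = cong (λ b → if b then replicate (a ∸ suc a) false ++ true ∷ q else q) (dec-false (suc a ≤? a) (<⇒≱ ≤-refl))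

extend-≤ : ∀ {a x} q → x ≤ a → extend a x q ≡ replicate (a ∸ x) false ++ true ∷ q
extend-≤ {a} {x} q x≤a = cong (λ b → if b then replicate (a ∸ x) false ++ true ∷ q else q) (dec-true (x ≤? a) x≤a)

-- The joint induction: once the flags q of the a undecided vertices are fixed, the later entries
-- trace the bicoloured paths from height `trues q`. If the next entry is a + 1, no clique ends at
-- the current vertex, and the flag of the next vertex selects U or H. If it is at most a, a clique
-- ends there, and that flag selects the other H or D.
∑chains-flags : ∀ m a (f : List Bool → ℕ → ℕ) →
  ∑chains a m (λ c → f (flags a c) (maxTrues a c))
    ≡ ∑flags a (λ q → ∑bicoloured m (trues q) (f q))
∑chains-flags zero    a f = sym (∑flags-falses a f)
∑chains-flags (suc m) a f = begin
  Σ< (suc (suc a)) (λ x → ∑chains x m (λ c → g (take a (extend a x (flags x c))) (maxTrues x c)))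
    ≡⟨ Σ<-cong (suc (suc a)) (λ x _ → ∑chains-flags m x (λ q → g (take a (extend a x q)))) ⟩
  Σ< (suc (suc a)) (λ x → ∑flags x (λ q → ∑bicoloured m (trues q) (g (take a (extend a x q)))))
    ≡⟨ cong₂ _+_
         (∑flags-cong (suc a) λ q → cong (λ l → ∑bicoloured m (trues q) (g (take a l))) (extend-> a q))
         (Σ<-cong (suc a) λ { x (s≤s x≤a) → ∑flags-cong x λ q → jump x≤a q }) ⟩
  ∑flags (suc a) (λ q → ∑bicoloured m (trues q) (g (take a q)))
    + Σ< (suc a) (λ x → ∑flags x (λ q → close (replicate (a ∸ x) false ++ true ∷ q)))
    ≡⟨ cong₂ _+_ (∑flags-snoc a (λ q t → ∑bicoloured m t (g q))) all-close ⟩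
  ∑flags a (λ q → ∑bicoloured m (suc (trues q)) (g q) + ∑bicoloured m (trues q) (g q))
    + ∑flags a (λ q → ∑bicoloured m (trues q) (g q) + atPred (λ h → ∑bicoloured m h (g q)) (trues q))
    ≡⟨ ∑flags-+ a _ _ ⟨
  ∑flags a (λ q → ∑bicoloured (suc m) (trues q) (f q)) ∎
  where
  g : List Bool → ℕ → ℕ
  g q h = f q (trues q ⊔ h)

  -- `atPred` discounts the first true flag: it marks the left end of the next vertex's own
  -- interval, which the height there does not count.
  close : List Bool → ℕ
  close q = atPred (λ h → ∑bicoloured m h (g (take a q))) (trues q)

  jump : ∀ {x} → x ≤ a → ∀ q →
    ∑bicoloured m (trues q) (g (take a (extend a x q))) ≡ close (replicate (a ∸ x) false ++ true ∷ q)
  jump {x} x≤a q rewrite extend-≤ q x≤a | trues-falses (a ∸ x) (true ∷ q) = refl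

  close-falses : close (replicate (suc a) false) ≡ 0
  close-falses = cong (atPred _) (trans (cong trues (sym (++-identityʳ (replicate (suc a) false)))) (trues-falses (suc a) []))

  -- The entries x ≤ a produce the flag lists of length a + 1 having a true flag. The all-false list
  -- adds 0 because `atPred` vanishes at 0, so the sum extends to all lists.
  all-close : Σ< (suc a) (λ x → ∑flags x (λ q → close (replicate (a ∸ x) false ++ true ∷ q)))
    ≡ ∑flags a (λ q → ∑bicoloured m (trues q) (g q) + atPred (λ h → ∑bicoloured m h (g q)) (trues q))
  all-close = begin
    Σ< (suc a) (λ x → ∑flags x (λ q → close (replicate (a ∸ x) false ++ true ∷ q)))
      ≡⟨ +-identityʳ _ ⟨
    Σ< (suc a) (λ x → ∑flags x (λ q → close (replicate (a ∸ x) false ++ true ∷ q))) + 0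
      ≡⟨ cong (λ z → Σ< (suc a) (λ x → ∑flags x (λ q → close (replicate (a ∸ x) false ++ true ∷ q))) + z) close-falses ⟨
    Σ< (suc a) (λ x → ∑flags x (λ q → close (replicate (a ∸ x) false ++ true ∷ q))) + close (replicate (suc a) false)
      ≡⟨ ∑flags-firstTrue (suc a) close ⟩
    ∑flags (suc a) close
      ≡⟨ ∑flags-snoc a (λ q t → atPred (λ h → ∑bicoloured m h (g q)) t) ⟩
    ∑flags a (λ q → ∑bicoloured m (trues q) (g q) + atPred (λ h → ∑bicoloured m h (g q)) (trues q)) ∎

-- Motzkin and Dyck paths

-- The height is kept as a natural number, so nonnegativity turns into the single forbidden case of
-- a down step at height 0.
IsMotzkinFrom : ∀ {m} → ℕ → Vec Step m → Set
IsMotzkinFrom h       []      = h ≡ 0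
IsMotzkinFrom h       (U ∷ p) = IsMotzkinFrom (suc h) p
IsMotzkinFrom zero    (D ∷ p) = ⊥
IsMotzkinFrom (suc h) (D ∷ p) = IsMotzkinFrom h p
IsMotzkinFrom h       (H ∷ p) = IsMotzkinFrom h p

isMotzkinFrom? : ∀ {m} h (p : Vec Step m) → Dec (IsMotzkinFrom h p)
isMotzkinFrom? h       []      = h ≟ 0
isMotzkinFrom? h       (U ∷ p) = isMotzkinFrom? (suc h) p
isMotzkinFrom? zero    (D ∷ p) = no λ ()
isMotzkinFrom? (suc h) (D ∷ p) = isMotzkinFrom? h p
isMotzkinFrom? h       (H ∷ p) = isMotzkinFrom? h p

-- A down step at height 0 gets the default `pred 0`; `isMotzkinFrom?` rejects such paths.
move : Step → ℕ → ℕ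
move U = suc
move D = pred
move H = id

heightFrom : ∀ {m} → ℕ → Vec Step m → ℕ
heightFrom h []      = h
heightFrom h (s ∷ p) = h ⊔ heightFrom (move s h) p

≤-heightFrom : ∀ {m} h (p : Vec Step m) → h ≤ heightFrom h p
≤-heightFrom h []      = ≤-refl
≤-heightFrom h (s ∷ p) = m≤m⊔n h _

slopes horizontals : ∀ {m} → Vec Step m → ℕ
slopes []      = 0
slopes (U ∷ p) = suc (slopes p)
slopes (D ∷ p) = suc (slopes p)
slopes (H ∷ p) = slopes p
horizontals []      = 0
horizontals (U ∷ p) = horizontals p
horizontals (D ∷ p) = horizontals p
horizontals (H ∷ p) = suc (horizontals p)

slopes+horizontals : ∀ {m} (p : Vec Step m) → slopes p + horizontals p ≡ m
slopes+horizontals []      = refl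
slopes+horizontals (U ∷ p) = cong suc (slopes+horizontals p)
slopes+horizontals (D ∷ p) = cong suc (slopes+horizontals p)
slopes+horizontals (H ∷ p) = trans (+-suc (slopes p) (horizontals p)) (cong suc (slopes+horizontals p))

-- Descending from height h to 0 takes h more down steps than up steps.
slopes-u : ∀ {m} h (p : Vec Step m) → IsMotzkinFrom h p → slopes p ≡ h + (u p + u p)
slopes-u h       []      refl = refl
slopes-u h       (U ∷ p) M = begin
  suc (slopes p)               ≡⟨ cong suc (slopes-u (suc h) p M) ⟩
  suc (suc (h + (u p + u p)))  ≡⟨ cong suc (+-suc h (u p + u p)) ⟨
  suc (h + suc (u p + u p))    ≡⟨ cong (λ z → suc (h + z)) (+-suc (u p) (u p)) ⟨
  suc (h + (u p + suc (u p)))  ≡⟨ +-suc h (u p + suc (u p)) ⟨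
  h + suc (u p + suc (u p))    ∎
slopes-u (suc h) (D ∷ p) M = cong suc (slopes-u h p M)
slopes-u h       (H ∷ p) M = slopes-u h p M

module _ {m} (p : Vec Step m) (M : IsMotzkinFrom 0 p) where

  slopes≡2u : slopes p ≡ 2 * u p
  slopes≡2u = trans (slopes-u 0 p M) (cong (u p +_) (sym (+-identityʳ (u p))))

  horizontals≡m∸2u : horizontals p ≡ m ∸ 2 * u p
  horizontals≡m∸2u = begin
    horizontals p                         ≡⟨ m+n∸m≡n (slopes p) (horizontals p) ⟨
    slopes p + horizontals p ∸ slopes p   ≡⟨ cong₂ _∸_ (slopes+horizontals p) slopes≡2u ⟩
    m ∸ 2 * u p                           ∎

  u≤⌊m/2⌋ : u p ≤ ⌊ m /2⌋
  u≤⌊m/2⌋ = subst (_≤ ⌊ m /2⌋) (sym (n≡⌊n+n/2⌋ (u p)))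
    (⌊n/2⌋-mono (subst₂ _≤_ (slopes-u 0 p M) (slopes+horizontals p) (m≤m+n (slopes p) (horizontals p))))

-- As IsMotzkin, but starting at an arbitrary ordinate.
EndsAtZero : ∀ {m} → ℤ → Vec Step m → Set
EndsAtZero {m} y p = lookup (ordinates y p) (fromℕ m) ≡ 0ℤ × All (0ℤ ℤ.≤_) (ordinates y p)

isMotzkin⇒from : ∀ {m} h (p : Vec Step m) → EndsAtZero (ℤ.+ h) p → IsMotzkinFrom h p
isMotzkin⇒from h       []      (refl , _)        = refl
isMotzkin⇒from h       (U ∷ p) (e , _ ∷ nonneg)  =
  isMotzkin⇒from (suc h) p (subst (λ y → EndsAtZero (ℤ.+ y) p) (+-comm h 1) (e , nonneg))
-- Splitting the tail lets `ordinates` compute: -1 appears as the end point in the first case and as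
-- the second ordinate in the other.
isMotzkin⇒from zero    (D ∷ [])    (() , _)
isMotzkin⇒from zero    (D ∷ s ∷ p) (_ , _ ∷ () ∷ _)
isMotzkin⇒from (suc h) (D ∷ p) (e , _ ∷ nonneg)  = isMotzkin⇒from h p (e , nonneg)
isMotzkin⇒from h       (H ∷ p) (e , _ ∷ nonneg)  =
  isMotzkin⇒from h p (subst (λ y → EndsAtZero (ℤ.+ y) p) (+-identityʳ h) (e , nonneg))

from⇒isMotzkin : ∀ {m} h (p : Vec Step m) → IsMotzkinFrom h p → EndsAtZero (ℤ.+ h) p
from⇒isMotzkin h       []      refl = refl , ℤ.+≤+ z≤n ∷ []
from⇒isMotzkin h       (U ∷ p) M    =
  map₂ (ℤ.+≤+ z≤n ∷_) (subst (λ y → EndsAtZero (ℤ.+ y) p) (+-comm 1 h) (from⇒isMotzkin (suc h) p M))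
from⇒isMotzkin (suc h) (D ∷ p) M    = map₂ (ℤ.+≤+ z≤n ∷_) (from⇒isMotzkin h p M)
from⇒isMotzkin h       (H ∷ p) M    =
  map₂ (ℤ.+≤+ z≤n ∷_) (subst (λ y → EndsAtZero (ℤ.+ y) p) (sym (+-identityʳ h)) (from⇒isMotzkin h p M))

max-ordinates : ∀ {m} h (p : Vec Step m) → IsMotzkinFrom h p →
                Vec.foldr′ ℤ._⊔_ 0ℤ (ordinates (ℤ.+ h) p) ≡ ℤ.+ heightFrom h p
max-ordinates h       []      M = cong ℤ.+_ (⊔-identityʳ h)
max-ordinates h       (U ∷ p) M = cong (ℤ.+ h ℤ.⊔_)
  (trans (cong (λ y → Vec.foldr′ ℤ._⊔_ 0ℤ (ordinates (ℤ.+ y) p)) (+-comm h 1)) (max-ordinates (suc h) p M))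
max-ordinates (suc h) (D ∷ p) M = cong (ℤ.+ suc h ℤ.⊔_) (max-ordinates h p M)
max-ordinates h       (H ∷ p) M = cong (ℤ.+ h ℤ.⊔_)
  (trans (cong (λ y → Vec.foldr′ ℤ._⊔_ 0ℤ (ordinates (ℤ.+ y) p)) (+-identityʳ h)) (max-ordinates h p M))

height-from : ∀ {m} (p : Vec Step m) → IsMotzkinFrom 0 p → height p ≡ heightFrom 0 p
height-from p M = cong ℤ.∣_∣ (max-ordinates 0 p M)

-- Being Motzkin is an indicator over all step vectors, so that the product structure of `vectors`
-- allows splitting off the first step.
∑motzkin : ∀ m → ℕ → (Vec Step m → ℕ) → ℕ
∑motzkin m h f = ∑ (vectors steps m) (λ p → when (isMotzkinFrom? h p) (f p))

∑motzkin-cong : ∀ m h {f g : Vec Step m → ℕ} → (∀ p → IsMotzkinFrom h p → f p ≡ g p) → ∑motzkin m h f ≡ ∑motzkin m h g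
∑motzkin-cong m h f≗g = ∑-cong (vectors steps m) λ p → when-cong (isMotzkinFrom? h p) (f≗g p)

∑motzkin-0 : ∀ m h → ∑motzkin m h (λ _ → 0) ≡ 0
∑motzkin-0 m h = trans (∑-cong (vectors steps m) λ p → when-0 (isMotzkinFrom? h p)) (∑-zero (vectors steps m))

∑motzkin-suc : ∀ m h (f : Vec Step (suc m) → ℕ) →
  ∑motzkin (suc m) h f ≡ ∑motzkin m (suc h) (f ∘ (U ∷_))
    + (atPred (λ g → ∑motzkin m g (f ∘ (D ∷_))) h + ∑motzkin m h (f ∘ (H ∷_)))
∑motzkin-suc m h f = begin
  ∑motzkin (suc m) h f
    ≡⟨ ∑-cartesianProductWith _∷_ steps (vectors steps m) (λ p → when (isMotzkinFrom? h p) (f p)) ⟩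
  ∑motzkin m (suc h) (f ∘ (U ∷_)) + (descents h + (∑motzkin m h (f ∘ (H ∷_)) + 0))
    ≡⟨ cong₂ (λ d e → ∑motzkin m (suc h) (f ∘ (U ∷_)) + (d + e)) (descents-atPred h) (+-identityʳ _) ⟩
  ∑motzkin m (suc h) (f ∘ (U ∷_))
    + (atPred (λ g → ∑motzkin m g (f ∘ (D ∷_))) h + ∑motzkin m h (f ∘ (H ∷_))) ∎
  where
  descents : ℕ → ℕ
  descents h = ∑ (vectors steps m) (λ p → when (isMotzkinFrom? h (D ∷ p)) (f (D ∷ p)))

  descents-atPred : ∀ h → descents h ≡ atPred (λ g → ∑motzkin m g (f ∘ (D ∷_))) h
  descents-atPred zero    = ∑-zero (vectors steps m)
  descents-atPred (suc h) = refl

∑-motzkinPaths : ∀ m (f : Vec Step m → ℕ) → ∑ (motzkinPaths m) f ≡ ∑motzkin m 0 f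
∑-motzkinPaths m f = trans (∑-filter isMotzkin? (vectors steps m) f)
  (∑-cong (vectors steps m) λ p →
    when-⇔ (isMotzkin⇒from 0 p) (from⇒isMotzkin 0 p) (isMotzkin? p) (isMotzkinFrom? 0 p) (f p))

-- The factor 2 ^ horizontals p counts the colourings of p.
∑motzkin-bicoloured : ∀ m h (f : ℕ → ℕ) →
  ∑motzkin m h (λ p → 2 ^ horizontals p * f (heightFrom h p)) ≡ ∑bicoloured m h f
∑motzkin-bicoloured zero    zero    f = trans (+-identityʳ _) (+-identityʳ _)
∑motzkin-bicoloured zero    (suc h) f = refl
∑motzkin-bicoloured (suc m) h       f = begin
  ∑motzkin (suc m) h (λ p → 2 ^ horizontals p * f (heightFrom h p))
    ≡⟨ ∑motzkin-suc m h _ ⟩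
  ∑motzkin m (suc h) (λ p → 2 ^ horizontals p * f⊔ (heightFrom (suc h) p))
    + (atPred (λ g → ∑motzkin m g (λ p → 2 ^ horizontals p * f⊔ (heightFrom (pred h) p))) h
       + ∑motzkin m h (λ p → 2 * 2 ^ horizontals p * f⊔ (heightFrom h p)))
    ≡⟨ cong₂ _+_ (∑motzkin-bicoloured m (suc h) f⊔) (cong₂ _+_ (descents h) double) ⟩
  b↑ + (b↓ + (b + b))
    ≡⟨ cong (b↑ +_) (trans (+-comm b↓ (b + b)) (+-assoc b b b↓)) ⟩
  b↑ + (b + (b + b↓))
    ≡⟨ +-assoc b↑ b (b + b↓) ⟨
  (b↑ + b) + (b + b↓) ∎
  where
  f⊔ : ℕ → ℕ
  f⊔ = f ∘ (h ⊔_)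

  b↑ b b↓ : ℕ
  b↑ = ∑bicoloured m (suc h) f⊔
  b  = ∑bicoloured m h f⊔
  b↓ = atPred (λ g → ∑bicoloured m g f⊔) h

  descents : ∀ k → atPred (λ g → ∑motzkin m g (λ p → 2 ^ horizontals p * f⊔ (heightFrom (pred k) p))) k
                   ≡ atPred (λ g → ∑bicoloured m g f⊔) k
  descents zero    = refl
  descents (suc g) = ∑motzkin-bicoloured m g f⊔

  double : ∑motzkin m h (λ p → 2 * 2 ^ horizontals p * f⊔ (heightFrom h p)) ≡ b + b
  double = begin
    ∑motzkin m h (λ p → 2 * 2 ^ horizontals p * f⊔ (heightFrom h p))
      ≡⟨ ∑-cong (vectors steps m) (λ p →
           trans (cong (when (isMotzkinFrom? h p)) (*-assoc 2 (2 ^ horizontals p) _))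
                 (sym (when-* 2 (isMotzkinFrom? h p) _))) ⟩
    ∑ (vectors steps m) (λ p → 2 * when (isMotzkinFrom? h p) (2 ^ horizontals p * f⊔ (heightFrom h p)))
      ≡⟨ ∑-*ˡ 2 (vectors steps m) _ ⟩
    2 * ∑motzkin m h (λ p → 2 ^ horizontals p * f⊔ (heightFrom h p))
      ≡⟨ cong (2 *_) (∑motzkin-bicoloured m h f⊔) ⟩
    2 * b
      ≡⟨ cong (b +_) (+-identityʳ b) ⟩
    b + b ∎

∑-motzkinPaths-u : ∀ m i (f : ℕ → ℕ) →
  ∑ (filter (λ M → u M ≟ i) (motzkinPaths m)) (f ∘ height)
    ≡ ∑motzkin m 0 (λ p → when (u p ≟ i) (f (heightFrom 0 p)))
∑-motzkinPaths-u m i f = begin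
  ∑ (filter (λ M → u M ≟ i) (motzkinPaths m)) (f ∘ height)
    ≡⟨ ∑-filter (λ M → u M ≟ i) (motzkinPaths m) (f ∘ height) ⟩
  ∑ (motzkinPaths m) (λ p → when (u p ≟ i) (f (height p)))
    ≡⟨ ∑-motzkinPaths m _ ⟩
  ∑motzkin m 0 (λ p → when (u p ≟ i) (f (height p)))
    ≡⟨ ∑motzkin-cong m 0 (λ p M → cong (when (u p ≟ i) ∘ f) (height-from p M)) ⟩
  ∑motzkin m 0 (λ p → when (u p ≟ i) (f (heightFrom 0 p))) ∎

-- A path with i up steps has m - 2i horizontal ones, so the weight counts its colourings. Since 2i
-- ≤ m, each path is met at exactly one index i.
∑-by-u : ∀ m (f : ℕ → ℕ) →
  ∑ (upTo (suc ⌊ m /2⌋)) (λ i → 2 ^ (m ∸ 2 * i) * ∑ (filter (λ M → u M ≟ i) (motzkinPaths m)) (f ∘ height))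
    ≡ ∑bicoloured m 0 f
∑-by-u m f = begin
  ∑ is (λ i → 2 ^ (m ∸ 2 * i) * ∑ (filter (λ M → u M ≟ i) (motzkinPaths m)) (f ∘ height))
    ≡⟨ ∑-cong is (λ i → begin
         2 ^ (m ∸ 2 * i) * ∑ (filter (λ M → u M ≟ i) (motzkinPaths m)) (f ∘ height)
           ≡⟨ cong (2 ^ (m ∸ 2 * i) *_) (∑-motzkinPaths-u m i f) ⟩
         2 ^ (m ∸ 2 * i) * ∑motzkin m 0 (λ p → when (u p ≟ i) (f (heightFrom 0 p)))
           ≡⟨ ∑-*ˡ (2 ^ (m ∸ 2 * i)) (vectors steps m) _ ⟨
         ∑ (vectors steps m) (λ p → 2 ^ (m ∸ 2 * i) * when (isMotzkinFrom? 0 p) (when (u p ≟ i) (f (heightFrom 0 p))))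
           ≡⟨ ∑-cong (vectors steps m) (λ p → trans (when-* (2 ^ (m ∸ 2 * i)) (isMotzkinFrom? 0 p) _)
                (cong (when (isMotzkinFrom? 0 p)) (when-* (2 ^ (m ∸ 2 * i)) (u p ≟ i) _))) ⟩
         ∑motzkin m 0 (λ p → when (u p ≟ i) (2 ^ (m ∸ 2 * i) * f (heightFrom 0 p))) ∎) ⟩
  ∑ is (λ i → ∑motzkin m 0 (λ p → when (u p ≟ i) (2 ^ (m ∸ 2 * i) * f (heightFrom 0 p))))
    ≡⟨ ∑-swap is (vectors steps m) _ ⟩
  ∑ (vectors steps m) (λ p → ∑ is (λ i → when (isMotzkinFrom? 0 p) (when (u p ≟ i) (2 ^ (m ∸ 2 * i) * f (heightFrom 0 p)))))
    ≡⟨ ∑-cong (vectors steps m) (λ p → ∑-when is (isMotzkinFrom? 0 p) _) ⟩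
  ∑motzkin m 0 (λ p → ∑ is (λ i → when (u p ≟ i) (2 ^ (m ∸ 2 * i) * f (heightFrom 0 p))))
    ≡⟨ ∑motzkin-cong m 0 (λ p M → trans (∑-upTo (suc ⌊ m /2⌋) _)
         (trans (Σ<-indicator (suc ⌊ m /2⌋) (λ i → 2 ^ (m ∸ 2 * i) * f (heightFrom 0 p)) (s≤s (u≤⌊m/2⌋ p M)))
                (cong (λ e → 2 ^ e * f (heightFrom 0 p)) (sym (horizontals≡m∸2u p M))))) ⟩
  ∑motzkin m 0 (λ p → 2 ^ horizontals p * f (heightFrom 0 p))
    ≡⟨ ∑motzkin-bicoloured m 0 f ⟩
  ∑bicoloured m 0 f ∎
  where
  is = upTo (suc ⌊ m /2⌋)

-- Removing the horizontal steps

∑dyck : ℕ → ℕ → (ℕ → ℕ) → ℕ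
∑dyck zero    zero    f = f 0
∑dyck zero    (suc h) f = 0
∑dyck (suc j) h       f = ∑dyck j (suc h) (f ∘ (h ⊔_)) + atPred (λ g → ∑dyck j g (f ∘ (h ⊔_))) h

nC0≡1 : ∀ n → n C 0 ≡ 1
nC0≡1 n = trans (nCk≡nC[n∸k] {k = 0} {n = n} z≤n) (nCn≡1 n)

*-atPred : ∀ c (f : ℕ → ℕ) h → c * atPred f h ≡ atPred (λ g → c * f g) h
*-atPred c f zero    = *-zeroʳ c
*-atPred c f (suc h) = refl

-- Pascal's rule on the first step: if it is sloped, j - 1 of the other m steps are sloped,
-- otherwise j are. Horizontal steps reach no new height, so the maximal height is that of the path
-- formed by the sloped steps.
∑motzkin-slopes : ∀ m j h (f : ℕ → ℕ) →
  ∑motzkin m h (λ p → when (slopes p ≟ j) (f (heightFrom h p))) ≡ (m C j) * ∑dyck j h f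
∑motzkin-slopes zero zero    zero    f = refl
∑motzkin-slopes zero zero    (suc h) f = refl
∑motzkin-slopes zero (suc j) h       f = trans (+-identityʳ _)
  (trans (when-0 (h ≟ 0)) (cong (_* ∑dyck (suc j) h f) (sym (k>n⇒nCk≡0 {0} {suc j} (s≤s z≤n)))))
∑motzkin-slopes (suc m) j h f = begin
  ∑motzkin (suc m) h (λ p → when (slopes p ≟ j) (f (heightFrom h p)))
    ≡⟨ ∑motzkin-suc m h _ ⟩
  ∑motzkin m (suc h) (λ p → when (suc (slopes p) ≟ j) (f⊔ (heightFrom (suc h) p)))
    + (atPred (λ g → ∑motzkin m g (λ p → when (suc (slopes p) ≟ j) (f⊔ (heightFrom (pred h) p)))) h
       + ∑motzkin m h (λ p → when (slopes p ≟ j) (f⊔ (heightFrom h p))))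
    ≡⟨ cong₂ _+_ (sloped j (suc h)) (cong₂ _+_ (descents j h) (trans
         -- After a horizontal step the rest still starts at height h, so the maximum with h changes
         -- nothing.
         (∑motzkin-cong m h λ p _ → cong (when (slopes p ≟ j) ∘ f) (m≤n⇒m⊔n≡n (≤-heightFrom h p)))
         (∑motzkin-slopes m j h f))) ⟩
  atPred (λ i → (m C i) * ∑dyck i (suc h) f⊔) j
    + (atPred (λ g → atPred (λ i → (m C i) * ∑dyck i g f⊔) j) h + (m C j) * ∑dyck j h f)
    ≡⟨ pascal j ⟩
  (suc m C j) * ∑dyck j h f ∎
  where
  f⊔ : ℕ → ℕ
  f⊔ = f ∘ (h ⊔_)

  sloped : ∀ j g → ∑motzkin m g (λ p → when (suc (slopes p) ≟ j) (f⊔ (heightFrom g p)))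
                   ≡ atPred (λ i → (m C i) * ∑dyck i g f⊔) j
  sloped zero    g = ∑motzkin-0 m g
  sloped (suc i) g = trans
    (∑motzkin-cong m g λ p _ → when-⇔ suc-injective (cong suc) (suc (slopes p) ≟ suc i) (slopes p ≟ i) _)
    (∑motzkin-slopes m i g f⊔)

  descents : ∀ j k → atPred (λ g → ∑motzkin m g (λ p → when (suc (slopes p) ≟ j) (f⊔ (heightFrom (pred k) p)))) k
                   ≡ atPred (λ g → atPred (λ i → (m C i) * ∑dyck i g f⊔) j) k
  descents j zero    = refl
  descents j (suc g) = sloped j g

  pascal : ∀ j → atPred (λ i → (m C i) * ∑dyck i (suc h) f⊔) j
    + (atPred (λ g → atPred (λ i → (m C i) * ∑dyck i g f⊔) j) h + (m C j) * ∑dyck j h f)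
    ≡ (suc m C j) * ∑dyck j h f
  pascal zero = cong₂ _+_ (zeros h) (cong (_* ∑dyck 0 h f) (trans (nC0≡1 m) (sym (nC0≡1 (suc m)))))
    where
    zeros : ∀ h → atPred (λ _ → 0) h ≡ 0
    zeros zero    = refl
    zeros (suc h) = refl
  pascal (suc i) = begin
    (m C i) * ∑dyck i (suc h) f⊔ + (atPred (λ g → (m C i) * ∑dyck i g f⊔) h + (m C suc i) * E)
      ≡⟨ +-assoc ((m C i) * ∑dyck i (suc h) f⊔) _ _ ⟨
    (m C i) * ∑dyck i (suc h) f⊔ + atPred (λ g → (m C i) * ∑dyck i g f⊔) h + (m C suc i) * E
      ≡⟨ cong (λ z → (m C i) * ∑dyck i (suc h) f⊔ + z + (m C suc i) * E) (*-atPred (m C i) (λ g → ∑dyck i g f⊔) h) ⟨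
    (m C i) * ∑dyck i (suc h) f⊔ + (m C i) * atPred (λ g → ∑dyck i g f⊔) h + (m C suc i) * E
      ≡⟨ cong (_+ (m C suc i) * E) (*-distribˡ-+ (m C i) (∑dyck i (suc h) f⊔) (atPred (λ g → ∑dyck i g f⊔) h)) ⟨
    (m C i) * E + (m C suc i) * E
      ≡⟨ *-distribʳ-+ E (m C i) (m C suc i) ⟨
    (m C i + m C suc i) * E
      ≡⟨ cong (_* E) (nCk+nC[k+1]≡[n+1]C[k+1] m i) ⟩
    (suc m C suc i) * E ∎
    where
    E = ∑dyck (suc i) h f

noH? : ∀ {m} (p : Vec Step m) → Dec (All (λ s → ¬ s ≡ H) p)
noH? p = All.all? (λ s → ¬? (s ≟ˢ H)) p

∑motzkin-noH : ∀ m h (f : ℕ → ℕ) → ∑motzkin m h (λ p → when (noH? p) (f (heightFrom h p))) ≡ ∑dyck m h f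
∑motzkin-noH zero    zero    f = +-identityʳ (f 0)
∑motzkin-noH zero    (suc h) f = refl
∑motzkin-noH (suc m) h       f = begin
  ∑motzkin (suc m) h (λ p → when (noH? p) (f (heightFrom h p)))
    ≡⟨ ∑motzkin-suc m h _ ⟩
  ∑motzkin m (suc h) (λ p → when (noH? (U ∷ p)) (f⊔ (heightFrom (suc h) p)))
    + (atPred (λ g → ∑motzkin m g (λ p → when (noH? (D ∷ p)) (f⊔ (heightFrom (pred h) p)))) h
       + ∑motzkin m h (λ p → when (noH? (H ∷ p)) (f⊔ (heightFrom h p))))
    ≡⟨ cong₂ _+_ (sloped U (λ ()) (suc h)) (cong₂ _+_ (descents h) (trans
         (∑motzkin-cong m h λ p _ → when-no (noH? (H ∷ p)) (λ { (s≢H ∷ _) → s≢H refl }) (f⊔ (heightFrom h p)))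
         (∑motzkin-0 m h))) ⟩
  ∑dyck m (suc h) f⊔ + (atPred (λ g → ∑dyck m g f⊔) h + 0)
    ≡⟨ cong (∑dyck m (suc h) f⊔ +_) (+-identityʳ _) ⟩
  ∑dyck (suc m) h f ∎
  where
  f⊔ : ℕ → ℕ
  f⊔ = f ∘ (h ⊔_)

  sloped : ∀ s → ¬ s ≡ H → ∀ g → ∑motzkin m g (λ p → when (noH? (s ∷ p)) (f⊔ (heightFrom g p))) ≡ ∑dyck m g f⊔
  sloped s s≢H g = trans
    (∑motzkin-cong m g λ p _ → when-⇔ All.tail (s≢H ∷_) (noH? (s ∷ p)) (noH? p) _)
    (∑motzkin-noH m g f⊔)

  descents : ∀ k → atPred (λ g → ∑motzkin m g (λ p → when (noH? (D ∷ p)) (f⊔ (heightFrom (pred k) p)))) k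
                   ≡ atPred (λ g → ∑dyck m g f⊔) k
  descents zero    = refl
  descents (suc g) = sloped D (λ ()) g

∑-Dyck : ∀ i (f : ℕ → ℕ) → ∑ (Dyck i) (f ∘ height) ≡ ∑dyck (2 * i) 0 f
∑-Dyck i f = begin
  ∑ (Dyck i) (f ∘ height)
    ≡⟨ ∑-filter noH? (motzkinPaths (2 * i)) (f ∘ height) ⟩
  ∑ (motzkinPaths (2 * i)) (λ p → when (noH? p) (f (height p)))
    ≡⟨ ∑-motzkinPaths (2 * i) _ ⟩
  ∑motzkin (2 * i) 0 (λ p → when (noH? p) (f (height p)))
    ≡⟨ ∑motzkin-cong (2 * i) 0 (λ p M → cong (when (noH? p) ∘ f) (height-from p M)) ⟩
  ∑motzkin (2 * i) 0 (λ p → when (noH? p) (f (heightFrom 0 p)))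
    ≡⟨ ∑motzkin-noH (2 * i) 0 f ⟩
  ∑dyck (2 * i) 0 f ∎

-- A Motzkin path with i up steps is a Dyck path of semilength i together with
-- the positions of its 2 i sloped steps.
∑-motzkinPaths-Dyck : ∀ m i (f : ℕ → ℕ) →
  ∑ (filter (λ M → u M ≟ i) (motzkinPaths m)) (f ∘ height) ≡ (m C (2 * i)) * ∑ (Dyck i) (f ∘ height)
∑-motzkinPaths-Dyck m i f = begin
  ∑ (filter (λ M → u M ≟ i) (motzkinPaths m)) (f ∘ height)
    ≡⟨ ∑-motzkinPaths-u m i f ⟩
  ∑motzkin m 0 (λ p → when (u p ≟ i) (f (heightFrom 0 p)))
    ≡⟨ ∑motzkin-cong m 0 (λ p M → when-⇔
         (λ u≡i → trans (slopes≡2u p M) (cong (2 *_) u≡i))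
         (λ s≡2i → *-cancelˡ-≡ (u p) i 2 (trans (sym (slopes≡2u p M)) s≡2i))
         (u p ≟ i) (slopes p ≟ 2 * i) _) ⟩
  ∑motzkin m 0 (λ p → when (slopes p ≟ 2 * i) (f (heightFrom 0 p)))
    ≡⟨ ∑motzkin-slopes m (2 * i) 0 f ⟩
  (m C (2 * i)) * ∑dyck (2 * i) 0 f
    ≡⟨ cong ((m C (2 * i)) *_) (∑-Dyck i f) ⟨
  (m C (2 * i)) * ∑ (Dyck i) (f ∘ height) ∎

-- Area sequences and their peak-cliques

-- The step condition for entries following a. With a first entry 0 it implies aᵢ < i, by
-- `chain-bound`.
Chain : ∀ {m} → ℕ → Vec ℕ m → Set
Chain a []      = ⊤
Chain a (x ∷ c) = x ≤ suc a × Chain x c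

chain? : ∀ {m} a (c : Vec ℕ m) → Dec (Chain a c)
chain? a []      = yes tt
chain? a (x ∷ c) = (x ≤? suc a) ×-dec chain? x c

chain-bound : ∀ {m} x (c : Vec ℕ m) → Chain x c → ∀ i → lookup (x ∷ c) i ≤ x + toℕ i
chain-bound x c       h       Fin.zero    = m≤m+n x 0
chain-bound x (y ∷ c) (y≤ , h) (Fin.suc i) =
  ≤-trans (chain-bound y c h i)
    (≤-trans (+-monoˡ-≤ (toℕ i) y≤) (≤-reflexive (sym (+-suc x (toℕ i)))))

-- Entries grow by at most one per step, so bⱼ = j - aⱼ weakly increases.
chain-mono : ∀ {m} x (c : Vec ℕ m) → Chain x c → ∀ j k → toℕ j ≤ toℕ k →
             lookup (x ∷ c) k + toℕ j ≤ lookup (x ∷ c) j + toℕ k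
chain-mono x c       h       Fin.zero    k           _         =
  ≤-trans (≤-reflexive (+-identityʳ _)) (chain-bound x c h k)
chain-mono x (y ∷ c) (_ , h) (Fin.suc j) (Fin.suc k) (s≤s j≤k) =
  subst₂ _≤_ (sym (+-suc _ (toℕ j))) (sym (+-suc _ (toℕ k))) (s≤s (chain-mono y c h j k j≤k))

steps⇒chain : ∀ {m} x (c : Vec ℕ m) →
  (∀ (i j : Fin (suc m)) → label i ≡ suc (label j) → lookup (x ∷ c) i ≤ lookup (x ∷ c) j + 1) → Chain x c
steps⇒chain x []      h = tt
steps⇒chain x (y ∷ c) h =
  ≤-trans (h (Fin.suc Fin.zero) Fin.zero refl) (≤-reflexive (+-comm x 1)) ,
  steps⇒chain y c λ i j e → h (Fin.suc i) (Fin.suc j) (cong suc e)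

chain⇒steps : ∀ {m} x (c : Vec ℕ m) → Chain x c →
  ∀ (i j : Fin (suc m)) → label i ≡ suc (label j) → lookup (x ∷ c) i ≤ lookup (x ∷ c) j + 1
chain⇒steps x (y ∷ c) (y≤ , h) (Fin.suc Fin.zero) Fin.zero    e = ≤-trans y≤ (≤-reflexive (+-comm 1 x))
chain⇒steps x (y ∷ c) (y≤ , h) (Fin.suc i)        (Fin.suc j) e = chain⇒steps y c h i j (suc-injective e)

isAreaSequence⇒chain : ∀ {m} x (c : Vec ℕ m) → IsAreaSequence (x ∷ c) → 0 ≡ x × Chain x c
isAreaSequence⇒chain x c (pos , h) = sym (n≤0⇒n≡0 (s≤s⁻¹ (pos Fin.zero))) , steps⇒chain x c h

chain⇒isAreaSequence : ∀ {m} x (c : Vec ℕ m) → 0 ≡ x × Chain x c → IsAreaSequence (x ∷ c)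
chain⇒isAreaSequence x c (refl , h) = (λ i → s≤s (chain-bound 0 c h i)) , chain⇒steps 0 c h

-- The hypothesis keeps every entry a chain can reach below n, so `upTo n` misses none. It survives
-- the step from a to x ≤ a + 1 because m drops by one.
∑-vectors-chain : ∀ n m a (f : Vec ℕ m → ℕ) → suc a + m ≤ n →
  ∑ (vectors (upTo n) m) (λ c → when (chain? a c) (f c)) ≡ ∑chains a m f
∑-vectors-chain n zero    a f _ = +-identityʳ (f [])
∑-vectors-chain n (suc m) a f a+m<n = begin
  ∑ (vectors (upTo n) (suc m)) (λ c → when (chain? a c) (f c))
    ≡⟨ ∑-cartesianProductWith _∷_ (upTo n) (vectors (upTo n) m) _ ⟩
  ∑ (upTo n) (λ x → ∑ (vectors (upTo n) m) (λ c → when (chain? a (x ∷ c)) (f (x ∷ c))))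
    ≡⟨ ∑-cong (upTo n) (λ x → begin
         ∑ (vectors (upTo n) m) (λ c → when (chain? a (x ∷ c)) (f (x ∷ c)))
           ≡⟨ ∑-cong (vectors (upTo n) m) (λ c → when-× (x ≤? suc a) (chain? x c) (f (x ∷ c))) ⟩
         ∑ (vectors (upTo n) m) (λ c → when (x ≤? suc a) (when (chain? x c) (f (x ∷ c))))
           ≡⟨ ∑-when (vectors (upTo n) m) (x ≤? suc a) _ ⟩
         when (x ≤? suc a) (∑ (vectors (upTo n) m) (λ c → when (chain? x c) (f (x ∷ c))))
           ≡⟨ when-cong (x ≤? suc a) (λ x≤ → ∑-vectors-chain n m x (f ∘ (x ∷_))
                (≤-trans (s≤s (+-monoˡ-≤ m x≤)) (≤-trans (≤-reflexive (cong suc (sym (+-suc a m)))) a+m<n))) ⟩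
         when (x ≤? suc a) (∑chains x m (f ∘ (x ∷_)))
           ≡⟨ when-⇔ s≤s s≤s⁻¹ (x ≤? suc a) (suc x ≤? suc (suc a)) _ ⟩
         when (suc x ≤? suc (suc a)) (∑chains x m (f ∘ (x ∷_))) ∎) ⟩
  ∑ (upTo n) (λ x → when (suc x ≤? suc (suc a)) (∑chains x m (f ∘ (x ∷_))))
    ≡⟨ ∑-upTo n _ ⟩
  Σ< n (λ x → when (suc x ≤? suc (suc a)) (∑chains x m (f ∘ (x ∷_))))
    ≡⟨ Σ<-bounded n (λ x → ∑chains x m (f ∘ (x ∷_)))
         (≤-trans (s≤s (≤-trans (s≤s (m≤m+n a m)) (≤-reflexive (sym (+-suc a m))))) a+m<n) ⟩
  ∑chains a (suc m) f ∎

-- An area sequence begins with 0, so the sum over the first entry has one term. Passing from `f` to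
-- `g` lets a statistic be replaced by a formula that holds on area sequences, such as
-- `pnest-chain`.
∑-DP : ∀ m (f g : Vec ℕ (suc m) → ℕ) → (∀ c → Chain 0 c → f (0 ∷ c) ≡ g (0 ∷ c)) →
  ∑ (DP (suc m)) f ≡ ∑chains 0 m (λ c → g (0 ∷ c))
∑-DP m f g f≗g = begin
  ∑ (DP (suc m)) f
    ≡⟨ ∑-filter isAreaSequence? (vectors (upTo (suc m)) (suc m)) f ⟩
  ∑ (vectors (upTo (suc m)) (suc m)) (λ a → when (isAreaSequence? a) (f a))
    ≡⟨ ∑-cartesianProductWith _∷_ (upTo (suc m)) (vectors (upTo (suc m)) m) _ ⟩
  ∑ (upTo (suc m)) (λ x → ∑ (vectors (upTo (suc m)) m) (λ c → when (isAreaSequence? (x ∷ c)) (f (x ∷ c))))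
    ≡⟨ ∑-cong (upTo (suc m)) (λ x → trans
         (∑-cong (vectors (upTo (suc m)) m) λ c → begin
            when (isAreaSequence? (x ∷ c)) (f (x ∷ c))
              ≡⟨ when-⇔ (isAreaSequence⇒chain x c) (chain⇒isAreaSequence x c)
                   (isAreaSequence? (x ∷ c)) ((0 ≟ x) ×-dec chain? x c) _ ⟩
            when ((0 ≟ x) ×-dec chain? x c) (f (x ∷ c))
              ≡⟨ when-cong ((0 ≟ x) ×-dec chain? x c) (λ { (refl , h) → f≗g c h }) ⟩
            when ((0 ≟ x) ×-dec chain? x c) (g (x ∷ c))
              ≡⟨ when-× (0 ≟ x) (chain? x c) _ ⟩
            when (0 ≟ x) (when (chain? x c) (g (x ∷ c))) ∎)
         (∑-when (vectors (upTo (suc m)) m) (0 ≟ x) _)) ⟩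
  ∑ (upTo (suc m)) (λ x → when (0 ≟ x) (∑ (vectors (upTo (suc m)) m) (λ c → when (chain? x c) (g (x ∷ c)))))
    ≡⟨ ∑-upTo (suc m) _ ⟩
  Σ< (suc m) (λ x → when (0 ≟ x) (∑ (vectors (upTo (suc m)) m) (λ c → when (chain? x c) (g (x ∷ c)))))
    ≡⟨ Σ<-indicator (suc m) (λ x → ∑ (vectors (upTo (suc m)) m) (λ c → when (chain? x c) (g (x ∷ c)))) (s≤s z≤n) ⟩
  ∑ (vectors (upTo (suc m)) m) (λ c → when (chain? 0 c) (g (0 ∷ c)))
    ≡⟨ ∑-vectors-chain (suc m) m 0 (λ c → g (0 ∷ c)) ≤-refl ⟩
  ∑chains 0 m (λ c → g (0 ∷ c)) ∎

-- Peak-cliques determined by their right ends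

PeakEnd : ∀ {n} → Vec ℕ n → Fin n → Set
PeakEnd {n} a j = ∀ (k : Fin n) → label k ≡ suc (label j) → lookup a k ≤ lookup a j

peakEnd? : ∀ {n} (a : Vec ℕ n) j → Dec (PeakEnd a j)
peakEnd? a j = Fin.all? λ k → (label k ≟ suc (label j)) →-dec (lookup a k ≤? lookup a j)

-- The summand at j stands for the clique {bⱼ,...,j}; the comparison of `toℕ j` with
-- `lookup a j + toℕ v` says that bⱼ ≤ v.
nesting : ∀ {n} → Vec ℕ n → Fin n → ℕ
nesting {n} a v =
  ∑ (allFin n) (λ j → when (peakEnd? a j) (when (toℕ j ≤? lookup a j + toℕ v) (when (toℕ v ≤? toℕ j) 1)))

module _ {n} (a : Vec ℕ n)
  (pos  : ∀ i → lookup a i < label i)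
  (mono : ∀ j k → toℕ j ≤ toℕ k → lookup a k + toℕ j ≤ lookup a j + toℕ k) where

  edge⇒≤ : ∀ {j i} → OrderedEdge a j i → label i ≤ label j + lookup a i
  edge⇒≤ {j} {i} (_ , le) = ≤-trans (m≤n+m∸n (label i) (lookup a i))
    (≤-trans (+-monoʳ-≤ (lookup a i) le) (≤-reflexive (+-comm (lookup a i) (label j))))

  ≤⇒edge : ∀ {j i} → label j < label i → label i ≤ label j + lookup a i → OrderedEdge a j i
  ≤⇒edge {j} {i} lt le = lt ,
    m≤n+o⇒m∸n≤o (label i) (lookup a i) (≤-trans le (≤-reflexive (+-comm (label j) (lookup a i))))

  edge-ordered : ∀ {i j} → label i < label j → Edge a i j → OrderedEdge a i j
  edge-ordered i<j (inj₁ e)         = e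
  edge-ordered i<j (inj₂ (j<i , _)) = contradiction (<-trans i<j j<i) (<-irrefl refl)

  -- Otherwise {i - 1, j} would be an edge. For i = 1 there is no vertex i - 1, and the bound is aⱼ
  -- < j.
  no-edge-left : ∀ {i j : Fin n} → label i ≤ label j →
    (∀ k → suc (label k) ≡ label i → ¬ Edge a k j) → label i + lookup a j ≤ label j
  no-edge-left {Fin.zero}  {j} i≤j noEdge = pos j
  no-edge-left {Fin.suc i} {j} i≤j noEdge = ≮⇒≥ λ lt →
    noEdge (inject₁ i) (cong (suc ∘ suc) (Fin.toℕ-inject₁ i))
      (inj₁ (≤⇒edge (subst (_< label j) (cong suc (sym (Fin.toℕ-inject₁ i))) i≤j)
        (subst (λ z → label j ≤ suc z + lookup a j) (sym (Fin.toℕ-inject₁ i)) (s≤s⁻¹ lt))))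

  -- The missing edge {i - 1, j} gives i ≤ bⱼ, and the edge {i, j} gives bⱼ ≤ i, which is trivial
  -- for an isolated vertex. The missing edge {i, j + 1} gives aⱼ₊₁ ≤ aⱼ.
  peakEdge⇒ : ∀ i j → PeakEdge a i j → label i + lookup a j ≡ label j × PeakEnd a j
  peakEdge⇒ i .i (inj₁ (refl , isolated)) =
    ≤-antisym
      (no-edge-left ≤-refl λ k e edge → isolated k (swap edge))
      (m≤m+n (label i) (lookup a i)) ,
    λ k e → ≮⇒≥ λ lt → isolated k (inj₁ (≤⇒edge (≤-reflexive (sym e))
      (≤-trans (≤-reflexive (trans e (+-comm 1 (label i))))
               (+-monoʳ-≤ (label i) (≤-trans (s≤s z≤n) lt)))))
  peakEdge⇒ i j (inj₂ (i<j , edge , noRight , noLeft)) =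
    eq ,
    λ k e → ≮⇒≥ λ lt →
      noRight k e (inj₁ (≤⇒edge (<-trans i<j (≤-reflexive (sym e)))
        (≤-trans (≤-reflexive (trans e (trans (cong suc (sym eq)) (sym (+-suc (label i) (lookup a j))))))
                 (+-monoʳ-≤ (label i) lt))))
    where
    eq = ≤-antisym (no-edge-left (<⇒≤ i<j) noLeft) (edge⇒≤ (edge-ordered i<j edge))

  peakEdge⇐ : ∀ i j → label i + lookup a j ≡ label j × PeakEnd a j → PeakEdge a i j
  peakEdge⇐ i j (eq , end) with m≤n⇒m<n∨m≡n (≤-trans (m≤m+n (label i) (lookup a j)) (≤-reflexive eq))
  ... | inj₁ i<j = inj₂ (i<j , inj₁ (≤⇒edge i<j (≤-reflexive (sym eq))) , noRight , noLeft)
    where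
    noRight : ∀ k → label k ≡ suc (label j) → ¬ Edge a i k
    noRight k e edge = <-irrefl refl (≤-trans (≤-reflexive (sym e))
      (≤-trans (edge⇒≤ (edge-ordered (<-trans i<j (≤-reflexive (sym e))) edge))
        (≤-trans (+-monoʳ-≤ (label i) (end k e)) (≤-reflexive eq))))

    noLeft : ∀ k → suc (label k) ≡ label i → ¬ Edge a k j
    noLeft k e edge = <-irrefl refl (≤-trans
      (s≤s (edge⇒≤ (edge-ordered (<-trans (≤-reflexive e) i<j) edge)))
      (≤-reflexive (trans (cong (_+ lookup a j) e) eq)))
  ... | inj₂ i≡j with Fin.toℕ-injective (suc-injective i≡j)
  ... | refl = inj₁ (refl , isolated)
    where
    aᵢ≡0 : lookup a i ≡ 0
    aᵢ≡0 = +-cancelˡ-≡ (label i) (lookup a i) 0 (trans eq (sym (+-identityʳ (label i))))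

    isolated : Isolated a i
    isolated k (inj₂ (k<i , le)) =
      <-irrefl refl (≤-trans k<i (subst (λ z → label i ∸ z ≤ label k) aᵢ≡0 le))
    -- The edge forces aₖ ≥ k - i. But aᵢ₊₁ ≤ aᵢ = 0, and `mono` from i + 1 to k gives aₖ ≤ k - i -
    -- 1.
    isolated k (inj₁ e@(i<k , _)) = <-irrefl refl (≤-trans (edge⇒≤ e) (≤-trans (≤-reflexive i⁺-label)
      (≤-trans (mono i⁺ k (subst (_≤ toℕ k) (sym (Fin.toℕ-fromℕ< i+1<n)) (s≤s⁻¹ i<k)))
        (+-monoˡ-≤ (toℕ k) (subst (lookup a i⁺ ≤_) aᵢ≡0 (end i⁺ (cong suc (Fin.toℕ-fromℕ< i+1<n))))))))
      where
      i+1<n : label i < n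
      i+1<n = ≤-<-trans (s≤s⁻¹ i<k) (Fin.toℕ<n k)

      i⁺ : Fin n
      i⁺ = fromℕ< i+1<n

      i⁺-label : label i + lookup a k ≡ lookup a k + toℕ i⁺
      i⁺-label = trans (+-comm (label i) (lookup a k)) (cong (lookup a k +_) (sym (Fin.toℕ-fromℕ< i+1<n)))

  -- A vertex j is the right end of at most one peak-clique, whose left end is bⱼ, so for each j the
  -- sum over left ends collapses to one term.
  peakNesting≡nesting : ∀ v → peakNesting a v ≡ nesting a v
  peakNesting≡nesting v = begin
    peakNesting a v
      ≡⟨ length-∑ (filter inside? (peakCliques a)) ⟩
    ∑ (filter inside? (peakCliques a)) (λ _ → 1)
      ≡⟨ ∑-filter inside? (peakCliques a) (λ _ → 1) ⟩
    ∑ (peakCliques a) (λ ij → when (inside? ij) 1)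
      ≡⟨ ∑-filter (λ (i , j) → peakEdge? a i j) (cartesianProduct (allFin n) (allFin n)) _ ⟩
    ∑ (cartesianProduct (allFin n) (allFin n)) (λ (i , j) → when (peakEdge? a i j) (when (inside? (i , j)) 1))
      ≡⟨ ∑-cartesianProductWith _,_ (allFin n) (allFin n) _ ⟩
    ∑ (allFin n) (λ i → ∑ (allFin n) (λ j → when (peakEdge? a i j) (when (inside? (i , j)) 1)))
      ≡⟨ ∑-swap (allFin n) (allFin n) _ ⟩
    ∑ (allFin n) (λ j → ∑ (allFin n) (λ i → when (peakEdge? a i j) (when (inside? (i , j)) 1)))
      ≡⟨ ∑-cong (allFin n) (λ j → trans (∑-cong (allFin n) λ i → cell i j)
           (∑-label n (term j) (≤-<-trans (m∸n≤m (toℕ j) (lookup a j)) (Fin.toℕ<n j)))) ⟩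
    ∑ (allFin n) term ∎
    where
    inside? : ∀ ((i , j) : Fin n × Fin n) → Dec (label i ≤ label v × label v ≤ label j)
    inside? (i , j) = (label i ≤? label v) ×-dec (label v ≤? label j)

    term : Fin n → ℕ
    term j = when (peakEnd? a j) (when (toℕ j ≤? lookup a j + toℕ v) (when (toℕ v ≤? toℕ j) 1))

    a≤ : ∀ j → lookup a j ≤ toℕ j
    a≤ j = s≤s⁻¹ (pos j)

    start : ∀ {i j} → label i ≡ suc (toℕ j ∸ lookup a j) → toℕ i + lookup a j ≡ toℕ j
    start {i} {j} e = trans (cong (_+ lookup a j) (suc-injective e)) (m∸n+n≡m (a≤ j))

    start? : ∀ i j → Dec (label i ≡ suc (toℕ j ∸ lookup a j))
    start? i j = label i ≟ suc (toℕ j ∸ lookup a j)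

    cell : ∀ i j → when (peakEdge? a i j) (when (inside? (i , j)) 1) ≡ when (start? i j) (term j)
    cell i j = begin
      when (peakEdge? a i j) (when (inside? (i , j)) 1)
        ≡⟨ when-⇔
             (λ pe → let eq , end = peakEdge⇒ i j pe in
               trans (sym (m+n∸n≡m (label i) (lookup a j)))
                 (trans (cong (_∸ lookup a j) eq) (+-∸-assoc 1 (a≤ j))) , end)
             (λ (e , end) → peakEdge⇐ i j (cong suc (start {i} {j} e) , end))
             (peakEdge? a i j) (start? i j ×-dec peakEnd? a j) _ ⟩
      when (start? i j ×-dec peakEnd? a j) (when (inside? (i , j)) 1)
        ≡⟨ when-× (start? i j) (peakEnd? a j) _ ⟩
      when (start? i j) (when (peakEnd? a j) (when (inside? (i , j)) 1))
        ≡⟨ when-cong (start? i j) (λ e → cong (when (peakEnd? a j)) (begin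
             when (inside? (i , j)) 1
               ≡⟨ when-× (label i ≤? label v) (label v ≤? label j) 1 ⟩
             when (label i ≤? label v) (when (label v ≤? label j) 1)
               ≡⟨ when-⇔
                    (λ i≤v → subst₂ _≤_ (start {i} {j} e) (+-comm (toℕ v) (lookup a j)) (+-monoˡ-≤ (lookup a j) (s≤s⁻¹ i≤v)))
                    (λ le → s≤s (+-cancelʳ-≤ (lookup a j) (toℕ i) (toℕ v)
                       (subst₂ _≤_ (sym (start {i} {j} e)) (+-comm (lookup a j) (toℕ v)) le)))
                    (label i ≤? label v) (toℕ j ≤? lookup a j + toℕ v) _ ⟩
             when (toℕ j ≤? lookup a j + toℕ v) (when (label v ≤? label j) 1)
               ≡⟨ cong (when (toℕ j ≤? lookup a j + toℕ v)) (when-⇔ s≤s⁻¹ s≤s (label v ≤? label j) (toℕ v ≤? toℕ j) 1) ⟩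
             when (toℕ j ≤? lookup a j + toℕ v) (when (toℕ v ≤? toℕ j) 1) ∎)) ⟩
      when (start? i j) (term j) ∎

-- Nesting numbers read off the flags

peakEnd-suc : ∀ {n} x (c : Vec ℕ n) j y → when (peakEnd? (x ∷ c) (Fin.suc j)) y ≡ when (peakEnd? c j) y
peakEnd-suc x c j y = when-⇔
  (λ end k e → end (Fin.suc k) (cong suc e))
  (λ { end (Fin.suc k) e → end k (suc-injective e) })
  (peakEnd? (x ∷ c) (Fin.suc j)) (peakEnd? c j) y

-- A clique whose right end is the first vertex contains no later vertex, and the other terms are
-- invariant under the shift.
nesting-suc : ∀ {n} x (c : Vec ℕ n) v → nesting (x ∷ c) (Fin.suc v) ≡ nesting c v
nesting-suc {n} x c v = begin
  nesting (x ∷ c) (Fin.suc v)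
    ≡⟨ ∑-allFin n _ ⟩
  when (peakEnd? (x ∷ c) Fin.zero) (when (0 ≤? x + suc (toℕ v)) 0)
    + ∑ (allFin n) (λ j → when (peakEnd? (x ∷ c) (Fin.suc j))
        (when (suc (toℕ j) ≤? lookup c j + suc (toℕ v)) (when (suc (toℕ v) ≤? suc (toℕ j)) 1)))
    ≡⟨ cong₂ _+_
         (trans (cong (when (peakEnd? (x ∷ c) Fin.zero)) (when-0 (0 ≤? x + suc (toℕ v))))
                (when-0 (peakEnd? (x ∷ c) Fin.zero)))
         (∑-cong (allFin n) λ j → trans (peakEnd-suc x c j _) (cong (when (peakEnd? c j)) (trans
            (when-⇔ (λ le → s≤s⁻¹ (subst (suc (toℕ j) ≤_) (+-suc (lookup c j) (toℕ v)) le))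
                    (λ le → subst (suc (toℕ j) ≤_) (sym (+-suc (lookup c j) (toℕ v))) (s≤s le))
                    (suc (toℕ j) ≤? lookup c j + suc (toℕ v)) (toℕ j ≤? lookup c j + toℕ v) _)
            (cong (when (toℕ j ≤? lookup c j + toℕ v))
                  (when-⇔ s≤s⁻¹ s≤s (suc (toℕ v) ≤? suc (toℕ j)) (toℕ v ≤? toℕ j) 1))))) ⟩
  nesting c v ∎

-- Counts the j with bⱼ ≤ 1 − o when bⱼ < bⱼ₊₁ or j is last; as the summation
-- moves along the sequence, o grows and 1 − o stands for an earlier vertex.
startingBy : ∀ {n} → ℕ → Vec ℕ n → ℕ
startingBy {n} o a = ∑ (allFin n) (λ j → when (peakEnd? a j) (when (o + toℕ j ≤? lookup a j) 1))

startingBy-∷ : ∀ {n} o x (c : Vec ℕ n) →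
  startingBy o (x ∷ c) ≡ when (peakEnd? (x ∷ c) Fin.zero) (when (o ≤? x) 1) + startingBy (suc o) c
startingBy-∷ {n} o x c = trans (∑-allFin n _) (cong₂ _+_
  (cong (λ z → when (peakEnd? (x ∷ c) Fin.zero) (when (z ≤? x) 1)) (+-identityʳ o))
  (∑-cong (allFin n) λ j → trans (peakEnd-suc x c j _)
    (cong (λ z → when (peakEnd? c j) (when (z ≤? lookup c j) 1)) (+-suc o (toℕ j)))))

nesting-zero : ∀ {n} x (c : Vec ℕ n) → nesting (x ∷ c) Fin.zero ≡ startingBy 0 (x ∷ c)
nesting-zero {n} x c = ∑-cong (allFin (suc n)) λ j → cong (when (peakEnd? (x ∷ c) j))
  (cong (λ z → when (toℕ j ≤? z) 1) (+-identityʳ (lookup (x ∷ c) j)))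

peakEnd-zero : ∀ {n} x y (c : Vec ℕ n) z → when (peakEnd? (x ∷ y ∷ c) Fin.zero) z ≡ when (y ≤? x) z
peakEnd-zero x y c z = when-⇔
  (λ end → end (Fin.suc Fin.zero) refl)
  (λ { y≤x (Fin.suc Fin.zero) _ → y≤x })
  (peakEnd? (x ∷ y ∷ c) Fin.zero) (y ≤? x) z

peakEnd-last : ∀ x z → when (peakEnd? (x ∷ []) Fin.zero) z ≡ z
peakEnd-last x z = when-yes (peakEnd? (x ∷ []) Fin.zero) (λ { Fin.zero () }) z

-- The bⱼ weakly increase, so all exceed the bound once the first does.
startingBy-0 : ∀ {m} o x (c : Vec ℕ m) → Chain x c → x < o → startingBy o (x ∷ c) ≡ 0
startingBy-0 o x []      h        x<o = trans (startingBy-∷ o x []) (cong (_+ 0)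
  (trans (cong (when (peakEnd? (x ∷ []) Fin.zero)) (when-no (o ≤? x) (<⇒≱ x<o) 1))
         (when-0 (peakEnd? (x ∷ []) Fin.zero))))
startingBy-0 o x (y ∷ c) (y≤ , h) x<o = trans (startingBy-∷ o x (y ∷ c)) (cong₂ _+_
  (trans (cong (when (peakEnd? (x ∷ y ∷ c) Fin.zero)) (when-no (o ≤? x) (<⇒≱ x<o) 1))
         (when-0 (peakEnd? (x ∷ y ∷ c) Fin.zero)))
  (startingBy-0 (suc o) y c h (s≤s (≤-trans y≤ x<o))))

take-take-≤ : ∀ {t n} (q : List Bool) → t ≤ n → take t (take n q) ≡ take t q
take-take-≤ {t} {n} q t≤n = trans (take-take t n q) (cong (λ k → take k q) (m≤n⇒m⊓n≡m t≤n))

trues-take-≤ : ∀ t e q → t ≤ e → trues (take t (replicate e false ++ true ∷ q)) ≡ 0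
trues-take-≤ zero    e       q t≤e       = refl
trues-take-≤ (suc t) (suc e) q (s≤s t≤e) = trues-take-≤ t e q t≤e

trues-take-> : ∀ t e q → e < t → trues (take t (replicate e false ++ true ∷ q)) ≡ suc (trues (take (t ∸ suc e) q))
trues-take-> (suc t) zero    q _         = refl
trues-take-> (suc t) (suc e) q (s≤s e<t) = trues-take-> t e q e<t

-- Number the vertices of `x ∷ c` from 1. Then b₁ = 1 - x, and the t flags kept belong to the
-- vertices from b₁ + 1 to 1 - o. Each left end among them starts one counted clique; the extra one
-- starts at b₁.
startingBy-flags : ∀ {m} o t x (c : Vec ℕ m) → Chain x c → o + t ≡ x →
  startingBy o (x ∷ c) ≡ suc (trues (take t (flags x c)))
startingBy-flags o t x [] h o+t≡x = trans (startingBy-∷ o x []) (begin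
  when (peakEnd? (x ∷ []) Fin.zero) (when (o ≤? x) 1) + 0
    ≡⟨ +-identityʳ _ ⟩
  when (peakEnd? (x ∷ []) Fin.zero) (when (o ≤? x) 1)
    ≡⟨ peakEnd-last x _ ⟩
  when (o ≤? x) 1
    ≡⟨ when-yes (o ≤? x) (subst (o ≤_) o+t≡x (m≤m+n o t)) 1 ⟩
  1
    ≡⟨ cong suc (trues-take-falses t x) ⟨
  suc (trues (take t (replicate x false))) ∎)
startingBy-flags o t x (y ∷ c) (y≤1+x , h) o+t≡x with m≤n⇒m<n∨m≡n y≤1+x
-- The next vertex has the same left end, so no clique ends here; o and x both grow by one and t
-- stays.
... | inj₂ refl = begin
  startingBy o (x ∷ suc x ∷ c)
    ≡⟨ startingBy-∷ o x (suc x ∷ c) ⟩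
  when (peakEnd? (x ∷ suc x ∷ c) Fin.zero) (when (o ≤? x) 1) + startingBy (suc o) (suc x ∷ c)
    ≡⟨ cong₂ _+_ (trans (peakEnd-zero x (suc x) c _) (when-no (suc x ≤? x) (<⇒≱ ≤-refl) (when (o ≤? x) 1)))
                 (startingBy-flags (suc o) t (suc x) c h (cong suc o+t≡x)) ⟩
  suc (trues (take t (flags (suc x) c)))
    ≡⟨ cong (λ q → suc (trues (take t q))) (extend-> x (flags (suc x) c)) ⟨
  suc (trues (take t (extend x (suc x) (flags (suc x) c))))
    ≡⟨ cong (suc ∘ trues) (take-take-≤ (extend x (suc x) (flags (suc x) c)) (subst (t ≤_) o+t≡x (m≤n+m t o))) ⟨
  suc (trues (take t (take x (extend x (suc x) (flags (suc x) c))))) ∎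
... | inj₁ (s≤s y≤x) = begin
  startingBy o (x ∷ y ∷ c)
    ≡⟨ startingBy-∷ o x (y ∷ c) ⟩
  when (peakEnd? (x ∷ y ∷ c) Fin.zero) (when (o ≤? x) 1) + startingBy (suc o) (y ∷ c)
    ≡⟨ cong (_+ startingBy (suc o) (y ∷ c)) (trans (peakEnd-zero x y c _)
         (trans (when-yes (y ≤? x) y≤x (when (o ≤? x) 1)) (when-yes (o ≤? x) (subst (o ≤_) o+t≡x (m≤m+n o t)) 1))) ⟩
  suc (startingBy (suc o) (y ∷ c))
    ≡⟨ cong suc later ⟩
  suc (trues (take t (replicate e false ++ true ∷ flags y c)))
    ≡⟨ cong (λ q → suc (trues (take t q))) (extend-≤ (flags y c) y≤x) ⟨
  suc (trues (take t (extend x y (flags y c))))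
    ≡⟨ cong (suc ∘ trues) (take-take-≤ (extend x y (flags y c)) (subst (t ≤_) o+t≡x (m≤n+m t o))) ⟨
  suc (trues (take t (take x (extend x y (flags y c))))) ∎
  where
  e : ℕ
  e = x ∸ y

  o+t≡y+e : o + t ≡ y + e
  o+t≡y+e = trans o+t≡x (sym (m+[n∸m]≡n y≤x))

  -- The next left end comes after e false flags. Either the cut precedes it and nothing more is
  -- counted, or t - e - 1 flags of the next list remain behind it.
  later : startingBy (suc o) (y ∷ c) ≡ trues (take t (replicate e false ++ true ∷ flags y c))
  later with t ≤? e
  ... | yes t≤e = trans
    (startingBy-0 (suc o) y c h (s≤s (+-cancelʳ-≤ e y o (≤-trans (≤-reflexive (sym o+t≡y+e)) (+-monoʳ-≤ o t≤e)))))
    (sym (trues-take-≤ t e (flags y c) t≤e))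
  ... | no t≰e = trans
    (startingBy-flags (suc o) (t ∸ suc e) y c h (+-cancelʳ-≡ e _ y (begin
      suc o + (t ∸ suc e) + e    ≡⟨ cong (_+ e) (+-suc o (t ∸ suc e)) ⟨
      o + suc (t ∸ suc e) + e    ≡⟨ +-assoc o _ e ⟩
      o + (suc (t ∸ suc e) + e)  ≡⟨ cong (o +_) (trans (sym (+-suc (t ∸ suc e) e)) (m∸n+n≡m (≰⇒> t≰e))) ⟩
      o + t                      ≡⟨ o+t≡y+e ⟩
      y + e                      ∎)))
    (sym (trues-take-> t e (flags y c) (≰⇒> t≰e)))

-- The peak-nesting as a maximum of flag counts

max-∷ : ∀ x xs → max 0 (x ∷ xs) ≡ x ⊔ max 0 xs
max-∷ x xs with ≤-total (max 0 xs) x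
... | inj₁ max≤x = sym (m≥n⇒m⊔n≡m max≤x)
... | inj₂ x≤max = sym (m≤n⇒m⊔n≡n x≤max)

max-allFin : ∀ n (f : Fin (suc n) → ℕ) →
  max 0 (map f (allFin (suc n))) ≡ f Fin.zero ⊔ max 0 (map (f ∘ Fin.suc) (allFin n))
max-allFin n f = trans (max-∷ (f Fin.zero) (map f (tabulate Fin.suc)))
  (cong (λ l → f Fin.zero ⊔ max 0 l) (trans (map-tabulate Fin.suc f) (sym (map-tabulate id (f ∘ Fin.suc)))))

-- The first vertex has nesting `startingBy 0`, one more than its number of true flags (here t = x
-- keeps all flags); `nesting-suc` leaves the other vertices to the tail.
max-nesting : ∀ {m} x (c : Vec ℕ m) → Chain x c →
  max 0 (map (nesting (x ∷ c)) (allFin (suc m))) ≡ suc (maxTrues x c)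
max-nesting {m} x c h = trans (max-allFin m (nesting (x ∷ c)))
  (trans (cong (λ l → nesting (x ∷ c) Fin.zero ⊔ max 0 l) (map-cong (nesting-suc x c) (allFin m)))
    (trans (cong (_⊔ max 0 (map (nesting c) (allFin m))) (trans (nesting-zero x c) (startingBy-flags 0 x x c h refl))) (rest c h)))
  where
  rest : ∀ {m} (c : Vec ℕ m) → Chain x c →
    suc (trues (take x (flags x c))) ⊔ max 0 (map (nesting c) (allFin m)) ≡ suc (maxTrues x c)
  rest []      _       = cong suc (trues-take-falses x x)
  rest (y ∷ c) (_ , h) = cong₂ _⊔_
    (cong (suc ∘ trues) (take-take-≤ {x} (extend x y (flags y c)) ≤-refl))
    (max-nesting y c h)

pnest-chain : ∀ {m} (c : Vec ℕ m) → Chain 0 c → pnest (0 ∷ c) ≡ suc (maxTrues 0 c)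
pnest-chain {m} c h = trans
  (cong (max 0) (map-cong (peakNesting≡nesting (0 ∷ c) (λ i → s≤s (chain-bound 0 c h i)) (chain-mono 0 c h)) (allFin (suc m))))
  (max-nesting 0 c h)

-- With first entry 0 no vertex is undecided at the start: in `∑chains-flags` the flag list is empty
-- and the paths start at height 0.
∑-DP-pnest : ∀ m (f : ℕ → ℕ) → ∑ (DP (suc m)) (f ∘ pnest) ≡ ∑bicoloured m 0 (f ∘ suc)
∑-DP-pnest m f = begin
  ∑ (DP (suc m)) (f ∘ pnest)
    ≡⟨ ∑-DP m (f ∘ pnest) (λ a → f (suc (maxTrues 0 (Vec.tail a)))) (λ c h → cong f (pnest-chain c h)) ⟩
  ∑chains 0 m (λ c → f (suc (maxTrues 0 c)))
    ≡⟨ ∑chains-flags m 0 (λ _ → f ∘ suc) ⟩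
  ∑bicoloured m 0 (f ∘ suc) ∎

-- Comparison of coefficients

coeff-by-u : ∀ m k →
  coeff (Σᵖ[ i ∈ upTo (suc ⌊ m /2⌋) ]
           (2 ^ (m ∸ 2 * i)) ·ᵖ (Σᵖ[ M ∈ filter (λ M → u M ≟ i) (motzkinPaths m) ] t^ (height M + 1))) k
    ≡ ∑ (upTo (suc ⌊ m /2⌋)) (λ i → 2 ^ (m ∸ 2 * i)
        * ∑ (filter (λ M → u M ≟ i) (motzkinPaths m)) (λ M → coeff (t^ (height M + 1)) k))
coeff-by-u m k =
  trans (coeff-Σᵖ (upTo (suc ⌊ m /2⌋)) (λ i → (2 ^ (m ∸ 2 * i)) ·ᵖ inner i) k)
    (∑-cong (upTo (suc ⌊ m /2⌋)) λ i → trans (coeff-·ᵖ (2 ^ (m ∸ 2 * i)) (inner i) k)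
      (cong (2 ^ (m ∸ 2 * i) *_)
        (coeff-Σᵖ (filter (λ M → u M ≟ i) (motzkinPaths m)) (λ M → t^ (height M + 1)) k)))
  where
  inner : ℕ → Poly
  inner i = Σᵖ[ M ∈ filter (λ M → u M ≟ i) (motzkinPaths m) ] t^ (height M + 1)

corollary3p12 : ∀ (n : ℕ) → 1 ≤ n →
    (Pnest n
    ≈ᵖ Σᵖ[ i ∈ upTo (suc ⌊ n ∸ 1 /2⌋) ]
    (2 ^ (n ∸ 1 ∸ 2 * i)) ·ᵖ
    (Σᵖ[ M ∈ filter (λ M → u M ≟ i) (MP n) ] t^ (height M + 1)))
    × (Σᵖ[ i ∈ upTo (suc ⌊ n ∸ 1 /2⌋) ]
    (2 ^ (n ∸ 1 ∸ 2 * i)) ·ᵖ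
    (Σᵖ[ M ∈ filter (λ M → u M ≟ i) (MP n) ] t^ (height M + 1))
    ≈ᵖ Σᵖ[ i ∈ upTo (suc ⌊ n ∸ 1 /2⌋) ]
    (2 ^ (n ∸ 1 ∸ 2 * i) * ((n ∸ 1) C (2 * i))) ·ᵖ
    (Σᵖ[ P ∈ Dyck i ] t^ (height P + 1)))
corollary3p12 (suc m) _ = peaks , dyck
  where
  is = upTo (suc ⌊ m /2⌋)

  peaks = λ k → begin
    coeff (Pnest (suc m)) k
      ≡⟨ coeff-Σᵖ (DP (suc m)) (λ a → t^ pnest a) k ⟩
    ∑ (DP (suc m)) (λ a → coeff (t^ pnest a) k)
      ≡⟨ ∑-DP-pnest m (λ h → coeff (t^ h) k) ⟩
    ∑bicoloured m 0 (λ h → coeff (t^ suc h) k)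
      ≡⟨ ∑-by-u m (λ h → coeff (t^ suc h) k) ⟨
    ∑ is (λ i → 2 ^ (m ∸ 2 * i) * ∑ (filter (λ M → u M ≟ i) (motzkinPaths m)) (λ M → coeff (t^ suc (height M)) k))
      ≡⟨ ∑-cong is (λ i → cong (2 ^ (m ∸ 2 * i) *_) (∑-cong (filter (λ M → u M ≟ i) (motzkinPaths m)) λ M →
           cong (λ h → coeff (t^ h) k) (+-comm 1 (height M)))) ⟩
    ∑ is (λ i → 2 ^ (m ∸ 2 * i) * ∑ (filter (λ M → u M ≟ i) (motzkinPaths m)) (λ M → coeff (t^ (height M + 1)) k))
      ≡⟨ coeff-by-u m k ⟨
    coeff (Σᵖ[ i ∈ is ] (2 ^ (m ∸ 2 * i)) ·ᵖ (Σᵖ[ M ∈ filter (λ M → u M ≟ i) (motzkinPaths m) ] t^ (height M + 1))) k ∎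

  dyck = λ k → begin
    coeff (Σᵖ[ i ∈ is ] (2 ^ (m ∸ 2 * i)) ·ᵖ (Σᵖ[ M ∈ filter (λ M → u M ≟ i) (motzkinPaths m) ] t^ (height M + 1))) k
      ≡⟨ coeff-by-u m k ⟩
    ∑ is (λ i → 2 ^ (m ∸ 2 * i) * ∑ (filter (λ M → u M ≟ i) (motzkinPaths m)) (λ M → coeff (t^ (height M + 1)) k))
      ≡⟨ ∑-cong is (λ i → begin
           2 ^ (m ∸ 2 * i) * ∑ (filter (λ M → u M ≟ i) (motzkinPaths m)) (λ M → coeff (t^ (height M + 1)) k)
             ≡⟨ cong (2 ^ (m ∸ 2 * i) *_) (∑-motzkinPaths-Dyck m i (λ h → coeff (t^ (h + 1)) k)) ⟩
           2 ^ (m ∸ 2 * i) * ((m C (2 * i)) * ∑ (Dyck i) (λ P → coeff (t^ (height P + 1)) k))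
             ≡⟨ *-assoc (2 ^ (m ∸ 2 * i)) (m C (2 * i)) _ ⟨
           2 ^ (m ∸ 2 * i) * (m C (2 * i)) * ∑ (Dyck i) (λ P → coeff (t^ (height P + 1)) k)
             ≡⟨ cong (2 ^ (m ∸ 2 * i) * (m C (2 * i)) *_) (coeff-Σᵖ (Dyck i) (λ P → t^ (height P + 1)) k) ⟨
           2 ^ (m ∸ 2 * i) * (m C (2 * i)) * coeff (Σᵖ[ P ∈ Dyck i ] t^ (height P + 1)) k
             ≡⟨ coeff-·ᵖ (2 ^ (m ∸ 2 * i) * (m C (2 * i))) (Σᵖ[ P ∈ Dyck i ] t^ (height P + 1)) k ⟨
           coeff ((2 ^ (m ∸ 2 * i) * (m C (2 * i))) ·ᵖ (Σᵖ[ P ∈ Dyck i ] t^ (height P + 1))) k ∎) ⟩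
    ∑ is (λ i → coeff ((2 ^ (m ∸ 2 * i) * (m C (2 * i))) ·ᵖ (Σᵖ[ P ∈ Dyck i ] t^ (height P + 1))) k)
      ≡⟨ coeff-Σᵖ is (λ i → (2 ^ (m ∸ 2 * i) * (m C (2 * i))) ·ᵖ (Σᵖ[ P ∈ Dyck i ] t^ (height P + 1))) k ⟨
    coeff (Σᵖ[ i ∈ is ] (2 ^ (m ∸ 2 * i) * (m C (2 * i))) ·ᵖ (Σᵖ[ P ∈ Dyck i ] t^ (height P + 1))) k ∎
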